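{- Let $\gamma$ be an ordinal, let $A$ be a set, and let $X\subseteq {}^{\gamma}A$ be a subspace (with respect to the bounded topology) whose weight is a cardinal $\lambda\geq\mathfrak{c}=2^{\aleph_0}$. Then there is no continuous weak $\lambda^+$-measure space $(X,\mathfrak{M},\mu)$; that is, for no positively totally ordered monoid $\mathbb{S}$ with an infinitary sum $\mathsf{Sum}$ is there a continuous weak $\lambda^+$-measure space $(X,\mathfrak{M},\mu)$ with $\mu$ taking values in $(\mathbb{S},\mathsf{Sum})$.
   Context: **Topology.** ${}^{\gamma}A$ is the set of sequences of elements of $A$ of length $\gamma$, with the bounded topology, generated by the cones $\mathbf{N}_s=\{x\in{}^{\gamma}A\mid s\subseteq x\}$ for $s\in{}^{<\gamma}A=\bigcup_{\alpha<\gamma}{}^{\alpha}A$. Subsets carry the subspace topology. The weight of a space is the minimal size of a basis. **Monoids and sums.** A positively totally ordered monoid is $\mathbb{S}=(S,0,+,\leq)$ where $+$ is associative (not necessarily commutative) with neutral element $0$, $\leq$ is a total order, $a\leq b$ and $c\leq d$ imply $a+c\leq b+d$, $0$ is the minimum of $\leq$, and $S\neq\{0\}$. ${}^{<\mathrm{On}}\mathbb{S}$ is the class of all sequences of elements of $S$ of ordinal length; $\mathrm{lh}(s)$ is the length of $s$. An infinitary sum on $\mathbb{S}$ is a partial function $\mathsf{Sum}:{}^{<\mathrm{On}}\mathbb{S}\to\mathbb{S}$ such that: (S1) $\mathsf{Sum}(\emptyset)=0$ and $\mathsf{Sum}(s)=s_0+\dots+s_n$ for every non-empty finite $s=(s_i)_{i\leq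 n}\in\mathrm{dom}(\mathsf{Sum})$; (S2) (continuity) for all $s\in\mathrm{dom}(\mathsf{Sum})$ of limit length, if $s\restriction\alpha\in\mathrm{dom}(\mathsf{Sum})$ for cofinally many $\alpha<\mathrm{lh}(s)$, then $\mathsf{Sum}(s)=\sup\{\mathsf{Sum}(s\restriction\alpha)\mid\alpha<\mathrm{lh}(s),\ s\restriction\alpha\in\mathrm{dom}(\mathsf{Sum})\}$. **Measures.** A weakly $\lambda^+$-measurable space is a pair $(X,\mathfrak{M})$ where $X$ is a topological space and $\mathfrak{M}$ is a family of subsets of $X$ closed under unions of size $\leq\lambda$ and containing all open subsets of $X$. A $\lambda^+$-measure on it (with values in $(\mathbb{S},\mathsf{Sum})$) is a partial function $\mu:\mathscr{P}(X)\to\mathbb{S}$ with $\mathfrak{M}\subseteq\mathrm{dom}(\mu)$ such that: (M1) $\mu(\emptyset)=0$; (M2) $\mu(X)>0$; (M3) $A\subseteq B$ implies $\mu(A)\leq\mu(B)$ for all $A,B\in\mathfrak{M}$; (M4) for every family $(A_i)_{i<\gamma}$ of pairwise disjoint sets of $\mathfrak{M}$ of length an ordinal $\gamma<\lambda^+$, we have $\langle\mu(A_i)\mid i<\gamma\rangle\in\mathrm{dom}(\mathsf{Sum})$ and $\mu(\bigcup_{i<\gamma}A_i)=\mathsf{Sum}(\langle\mu(A_i)\mid i<\gamma\rangle)$; (M5) for every $x\in X$ with $\{x\}\in\mathfrak{M}$ and every open local basis $\{A_i\mid i<\gamma\}$ at $x$ with $\gamma<\lambda^+$, $\mu(\{x\})=\inf_{i<\gamma}\mu(A_i)$.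 Then $(X,\mathfrak{M},\mu)$ is called a weak $\lambda^+$-measure space. It is continuous if $\{x\}\in\mathfrak{M}$ and $\mu(\{x\})=0$ for every $x\in X$. -}

module Defs where

open import Level using (Level; _⊔_; Lift; lift; lower) renaming (suc to lsuc)
open import Algebra.Bundles using (Monoid)
open import Algebra.Structures using (IsMonoid)
import Algebra.Definitions.RawMonoid as RawMonoidDefinitions
open import Data.Bool.Base using (Bool)
open import Data.Fin.Base using (Fin)
import Data.Fin.Base as Fin
import Data.Fin.Induction as Fin
import Data.Fin.Properties as Fin
open import Data.List.Base using (List; []; _∷_; _++_)
open import Data.List.Relation.Unary.All using (All; []; _∷_)
import Data.List.Relation.Unary.All.Properties as All
open import Data.Nat.Base using (ℕ; suc)
open import Data.Product using (Σ; Σ-syntax; ∃; ∃-syntax; _×_; _,_; proj₁; proj₂)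
open import Data.Unit.Polymorphic using (⊤; tt)
open import Function using (_∘_; _on_; id; _↣_; _↔_; _⇔_; Injection; Inverse; mk⇔; Equivalence)
open import Function.Definitions using (Injective)
open import Function.Properties.Inverse using (↔-refl; ↔-sym; ↔-trans)
open import Induction.WellFounded using (WellFounded)
open import Relation.Binary.Bundles using (Setoid)
open import Relation.Binary.Core using (Rel)
open import Relation.Binary.Definitions using (Irrelevant; _Respects_; Tri; tri<; tri≈; tri>)
open import Relation.Binary.Structures using (IsStrictTotalOrder; IsTotalOrder)
import Relation.Binary.Construct.NonStrictToStrict as ToStrict
import Relation.Binary.Construct.On as On
open import Relation.Binary.PropositionalEquality
  using (_≡_; refl; sym; trans; cong; subst; subst₂; setoid; isEquivalence; resp₂; _→-setoid_)
open import Relation.Nullary using (¬_)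
open import Relation.Unary using (Pred; _∈_; _≐_)

-- Sets are modelled by types; sets whose elements are functions or subsets
-- are modelled by setoids, compared extensionally.  All sets live in one
-- universe, which is arbitrary.

-- Every set has a choice function on its nonempty subsets.  The value must
-- depend only on the extension of the subset and not on the proof of
-- nonemptiness, which already contains an element: without this condition
-- the axiom would be trivially true.

AxiomOfChoice : ∀ a → Set (lsuc a)
AxiomOfChoice a = (A : Set a) →
  Σ[ c ∈ ((P : Pred A a) → ∃ P → A) ]
    (∀ P (p : ∃ P) → c P p ∈ P) ×
    (∀ P Q (p : ∃ P) (q : ∃ Q) → P ≐ Q → c P p ≡ c Q q)

record PartialFunction {a a′ b b′} (A : Setoid a a′) (B : Setoid b b′) (d : Level)
                       : Set (a ⊔ a′ ⊔ b ⊔ b′ ⊔ lsuc d) where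
  private
    module A = Setoid A
    module B = Setoid B
  field
    dom        : Pred A.Carrier d
    dom-resp   : dom Respects A._≈_
    apply      : ∀ x → x ∈ dom → B.Carrier
    -- taking x ≡ y: values do not depend on the proof of membership in dom
    apply-cong : ∀ {x y} (p : x ∈ dom) (q : y ∈ dom) → x A.≈ y → apply x p B.≈ apply y q

module _ {ℓ} (X : Setoid ℓ ℓ) where
  open Setoid X using (Carrier; _≈_)

  record Subset : Set (lsuc ℓ) where
    constructor mkSubset
    field
      pred : Pred Carrier ℓ
      resp : pred Respects _≈_

module _ {ℓ} {X : Setoid ℓ ℓ} where
  open Setoid X using (Carrier; _≈_) renaming (sym to ≈-sym; trans to ≈-trans)
  open Subset

  infix 4 _∈ˢ_ _≐ˢ_

  _∈ˢ_ : Carrier → Subset X → Set ℓ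
  x ∈ˢ U = x ∈ pred U

  _≐ˢ_ : Rel (Subset X) ℓ
  U ≐ˢ V = pred U ≐ pred V

  _⊆ˢ_ : Rel (Subset X) ℓ
  U ⊆ˢ V = ∀ {x} → x ∈ˢ U → x ∈ˢ V

  full : Subset X
  full = mkSubset (λ _ → ⊤) (λ _ _ → tt)

  _∩ˢ_ : Subset X → Subset X → Subset X
  U ∩ˢ V = mkSubset (λ x → x ∈ˢ U × x ∈ˢ V)
                    (λ x≈y (xU , xV) → resp U x≈y xU , resp V x≈y xV)

  ⋃ˢ : {I : Set ℓ} → (I → Subset X) → Subset X
  ⋃ˢ U = mkSubset (λ x → ∃[ i ] x ∈ˢ U i) (λ x≈y (i , xU) → i , resp (U i) x≈y xU)

  ｛_｝ˢ : Carrier → Subset X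
  ｛ x ｝ˢ = mkSubset (λ y → y ≈ x) (λ y≈z y≈x → ≈-trans (≈-sym y≈z) y≈x)

  Disjoint : Rel (Subset X) ℓ
  Disjoint U V = ∀ {x} → ¬ (x ∈ˢ U × x ∈ˢ V)

powerset : ∀ {ℓ} → Setoid ℓ ℓ → Setoid (lsuc ℓ) ℓ
powerset X = record
  { Carrier = Subset X
  ; _≈_ = _≐ˢ_
  ; isEquivalence = record
    { refl  = id , id
    ; sym   = λ (f , g) → g , f
    ; trans = λ (f , g) (f′ , g′) → f′ ∘ f , g ∘ g′
    }
  }

emptySubset : ∀ {ℓ} {X : Setoid ℓ ℓ} → Subset X
emptySubset {ℓ} = ⋃ˢ {I = Lift ℓ (Fin 0)} (λ ())

-- An ordinal is represented by a well-ordered set, up to order isomorphism.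

record Ordinal (ℓ : Level) : Set (lsuc ℓ) where
  field
    Carrier            : Set ℓ
    _<_                : Rel Carrier ℓ
    isStrictTotalOrder : IsStrictTotalOrder _≡_ _<_
    <-irrelevant       : Irrelevant _<_
    <-wellFounded      : WellFounded _<_

  open IsStrictTotalOrder isStrictTotalOrder public
    using (compare) renaming (trans to <-trans; irrefl to <-irrefl)

∣_∣ : ∀ {ℓ} → Ordinal ℓ → Set ℓ
∣ α ∣ = Ordinal.Carrier α

-- The initial segment {i | i < a}.  As a ranges over α, these are exactly
-- the ordinals smaller than α.

_↓_ : ∀ {ℓ} (α : Ordinal ℓ) → ∣ α ∣ → Ordinal ℓ
α ↓ a = record
  { Carrier = ∃[ i ] i < a
  ; _<_ = _<_ on proj₁
  ; isStrictTotalOrder = record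
    { isStrictPartialOrder = record
      { isEquivalence = isEquivalence
      ; irrefl   = λ { refl → <-irrefl refl }
      ; trans    = <-trans
      ; <-resp-≈ = resp₂ (_<_ on proj₁)
      }
    ; compare = cmp
    }
  ; <-irrelevant  = <-irrelevant
  ; <-wellFounded = On.wellFounded proj₁ <-wellFounded
  }
  where
  open Ordinal α
  cmp : ∀ (x y : ∃[ i ] i < a) → Tri (proj₁ x < proj₁ y) (x ≡ y) (proj₁ y < proj₁ x)
  cmp (i , p) (j , q) with compare i j
  ... | tri< i<j i≢j j≮i = tri< i<j (i≢j ∘ cong proj₁) j≮i
  ... | tri> i≮j i≢j j<i = tri> i≮j (i≢j ∘ cong proj₁) j<i
  ... | tri≈ i≮j refl j≮i = tri≈ i≮j (cong (i ,_) (<-irrelevant p q)) j≮i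

finiteOrdinal : ∀ {ℓ} → ℕ → Ordinal ℓ
finiteOrdinal {ℓ} n = record
  { Carrier = Lift ℓ (Fin n)
  ; _<_ = λ i j → Lift ℓ (lower i Fin.< lower j)
  ; isStrictTotalOrder = record
    { isStrictPartialOrder = record
      { isEquivalence = isEquivalence
      ; irrefl   = λ { refl (lift p) → Fin.<-irrefl refl p }
      ; trans    = λ (lift p) (lift q) → lift (Fin.<-trans p q)
      ; <-resp-≈ = resp₂ _
      }
    ; compare = cmp
    }
  ; <-irrelevant  = λ (lift p) (lift q) → cong lift (Fin.<-irrelevant p q)
  ; <-wellFounded = Subrelation.wellFounded lower (On.wellFounded lower Fin.<-wellFounded)
  }
  where
  open import Induction.WellFounded using (module Subrelation)
  cmp : ∀ (x y : Lift ℓ (Fin n)) →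
        Tri (Lift ℓ (lower x Fin.< lower y)) (x ≡ y) (Lift ℓ (lower y Fin.< lower x))
  cmp (lift i) (lift j) with Fin.<-cmp i j
  ... | tri< p q r = tri< (lift p) (q ∘ cong lower) (r ∘ lower)
  ... | tri> p q r = tri> (p ∘ lower) (q ∘ cong lower) (lift r)
  ... | tri≈ p refl r = tri≈ (p ∘ lower) refl (r ∘ lower)

module _ {ℓ} (α : Ordinal ℓ) where
  open Ordinal α

  IsLimit : Set ℓ
  IsLimit = ∣ α ∣ × (∀ i → ∃[ j ] i < j)

  Cofinally : ∀ {p} → Pred ∣ α ∣ p → Set (ℓ ⊔ p)
  Cofinally P = ∀ i → ∃[ j ] ¬ (j < i) × P j

module _ {ℓ} (S : Setoid ℓ ℓ) where
  private module S = Setoid S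

  Sequence : Set (lsuc ℓ)
  Sequence = Σ[ α ∈ Ordinal ℓ ] (∣ α ∣ → S.Carrier)

  -- Since ordinals are only determined up to isomorphism, two sequences are
  -- equal when an order isomorphism of their lengths matches their terms.

  record _≅_ (s t : Sequence) : Set ℓ where
    private
      module α = Ordinal (proj₁ s)
      module β = Ordinal (proj₁ t)
    field
      iso     : ∣ proj₁ s ∣ ↔ ∣ proj₁ t ∣
      ordered : ∀ i j → i α.< j ⇔ Inverse.to iso i β.< Inverse.to iso j
      terms   : ∀ i → proj₂ s i S.≈ proj₂ t (Inverse.to iso i)

  sequences : Setoid (lsuc ℓ) ℓ
  sequences = record
    { Carrier = Sequence
    ; _≈_ = _≅_
    ; isEquivalence = record
      { refl  = record
        { iso = ↔-refl ; ordered = λ _ _ → mk⇔ id id ; terms = λ _ → S.refl }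
      ; sym   = symm
      ; trans = λ e f → record
        { iso     = ↔-trans (iso e) (iso f)
        ; ordered = λ i j → mk⇔
            (Equivalence.to (ordered f _ _) ∘ Equivalence.to (ordered e i j))
            (Equivalence.from (ordered e i j) ∘ Equivalence.from (ordered f _ _))
        ; terms   = λ i → S.trans (terms e i) (terms f _)
        }
      }
    }
    where
    open _≅_
    symm : ∀ {s t} → s ≅ t → t ≅ s
    symm {α , s} {β , t} e = record
      { iso     = ↔-sym (iso e)
      ; ordered = λ i j → mk⇔
          (λ i<j → Equivalence.from (ordered e (from i) (from j))
                     (subst₂ β._<_ (sym (to-from i)) (sym (to-from j)) i<j))
          (λ p → subst₂ β._<_ (to-from i) (to-from j) (Equivalence.to (ordered e _ _) p))
      ; terms   = λ i → S.sym (subst (λ k → s (from i) S.≈ t k) (to-from i) (terms e (from i)))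
      }
      where
      module β = Ordinal β
      from    = Inverse.from (iso e)
      to-from : ∀ i → Inverse.to (iso e) (from i) ≡ i
      to-from i = Inverse.inverseˡ (iso e) refl

  _↾_ : (s : Sequence) → ∣ proj₁ s ∣ → Sequence
  (α , s) ↾ a = (α ↓ a) , s ∘ proj₁

-- A cardinal is represented by a set of that cardinality.

-- α < λ⁺ iff the cardinality of α is at most λ.

_<_⁺ : ∀ {ℓ} → Ordinal ℓ → Set ℓ → Set ℓ
α < Λ ⁺ = ∣ α ∣ ↣ Λ

𝔠≤_ : ∀ {ℓ} → Set ℓ → Set ℓ
𝔠≤ Λ = Injection (ℕ →-setoid Bool) (setoid Λ)

record TopologicalSpace (ℓ o : Level) : Set (lsuc (ℓ ⊔ o)) where
  field
    points    : Setoid ℓ ℓ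
    IsOpen    : Pred (Subset points) o
    open-resp : IsOpen Respects _≐ˢ_
    open-full : IsOpen full
    open-∩    : ∀ {U V} → IsOpen U → IsOpen V → IsOpen (U ∩ˢ V)
    open-⋃    : ∀ {I : Set ℓ} (U : I → Subset points) → (∀ i → IsOpen (U i)) → IsOpen (⋃ˢ U)

  Point : Set ℓ
  Point = Setoid.Carrier points

  open-∅ : IsOpen emptySubset
  open-∅ = open-⋃ _ λ ()

module _ {ℓ o} (T : TopologicalSpace ℓ o) where
  open TopologicalSpace T

  IsBasis : {I : Set ℓ} → (I → Subset points) → Set (lsuc ℓ ⊔ o)
  IsBasis B = (∀ i → IsOpen (B i)) ×
              (∀ U → IsOpen U → ∀ x → x ∈ˢ U → ∃[ i ] x ∈ˢ B i × B i ⊆ˢ U)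

  IsOpenLocalBasis : Point → {I : Set ℓ} → (I → Subset points) → Set (lsuc ℓ ⊔ o)
  IsOpenLocalBasis x B = (∀ i → IsOpen (B i) × x ∈ˢ B i) ×
                         (∀ U → IsOpen U → x ∈ˢ U → ∃[ i ] B i ⊆ˢ U)

  -- A basis of size |I|, enumerated without repetition by I.

  BasisOfSize : Set ℓ → Set (lsuc ℓ ⊔ o)
  BasisOfSize I = Σ[ B ∈ (I → Subset points) ] IsBasis B × Injective _≡_ _≐ˢ_ B

  HasWeight : Set ℓ → Set (lsuc ℓ ⊔ o)
  HasWeight Λ = BasisOfSize Λ × (∀ I → BasisOfSize I → Λ ↣ I)

-- U is open iff every point of U lies in a finite intersection of members
-- of the family which is contained in U; the empty intersection is the
-- whole space.

generatedBy : ∀ {ℓ} (X : Setoid ℓ ℓ) {I : Set ℓ} → (I → Subset X) → TopologicalSpace ℓ ℓ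
generatedBy X {I} G = record
  { points    = X
  ; IsOpen    = IsOpen
  ; open-resp = λ (U⊆V , V⊆U) o x x∈V →
      let is , x∈is , is⊆U = o x (V⊆U x∈V) in is , x∈is , λ y y∈is → U⊆V (is⊆U y y∈is)
  ; open-full = λ _ _ → [] , [] , λ _ _ → tt
  ; open-∩    = λ oU oV x (x∈U , x∈V) →
      let is , x∈is , is⊆U = oU x x∈U
          js , x∈js , js⊆V = oV x x∈V
      in is ++ js , All.++⁺ x∈is x∈js ,
         λ y y∈ → is⊆U y (All.++⁻ˡ is y∈) , js⊆V y (All.++⁻ʳ is y∈)
  ; open-⋃    = λ U oU x (i , x∈Ui) →
      let is , x∈is , is⊆Ui = oU i x x∈Ui in is , x∈is , λ y y∈is → i , is⊆Ui y y∈is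
  }
  where
  In : List I → Setoid.Carrier X → Set _
  In is x = All (λ i → x ∈ˢ G i) is

  IsOpen : Pred (Subset X) _
  IsOpen U = ∀ x → x ∈ˢ U → ∃[ is ] In is x × (∀ y → In is y → y ∈ˢ U)

subsetSetoid : ∀ {ℓ} {X : Setoid ℓ ℓ} → Subset X → Setoid ℓ ℓ
subsetSetoid {X = X} Y = record
  { Carrier = ∃[ x ] x ∈ˢ Y
  ; _≈_ = _≈_ on proj₁
  ; isEquivalence = On.isEquivalence proj₁ (Setoid.isEquivalence X)
  }
  where open Setoid X using (_≈_)

trace : ∀ {ℓ} {X : Setoid ℓ ℓ} (Y : Subset X) → Subset X → Subset (subsetSetoid Y)
trace Y U = mkSubset (λ x → proj₁ x ∈ˢ U) (Subset.resp U)

subspace : ∀ {ℓ o} (T : TopologicalSpace ℓ o) →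
           Subset (TopologicalSpace.points T) → TopologicalSpace ℓ (lsuc ℓ ⊔ o)
subspace T Y = record
  { points    = subsetSetoid Y
  ; IsOpen    = λ V → ∃[ U ] IsOpen U × V ≐ˢ trace Y U
  ; open-resp = λ (V⊆W , W⊆V) (U , oU , V⊆U , U⊆V) →
      U , oU , (λ x∈W → V⊆U (W⊆V x∈W)) , (λ x∈U → V⊆W (U⊆V x∈U))
  ; open-full = full , open-full , (λ _ → tt) , (λ _ → tt)
  ; open-∩    = λ (U , oU , V⊆U , U⊆V) (U′ , oU′ , V′⊆U′ , U′⊆V′) →
      U ∩ˢ U′ , open-∩ oU oU′ ,
      (λ (p , q) → V⊆U p , V′⊆U′ q) , (λ (p , q) → U⊆V p , U′⊆V′ q)
  ; open-⋃    = λ V oV →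
      ⋃ˢ (λ i → proj₁ (oV i)) , open-⋃ _ (λ i → proj₁ (proj₂ (oV i))) ,
      (λ (i , p) → i , proj₁ (proj₂ (proj₂ (oV i))) p) ,
      (λ (i , p) → i , proj₂ (proj₂ (proj₂ (oV i))) p)
  }
  where open TopologicalSpace T

module _ {ℓ} (γ : Ordinal ℓ) (A : Set ℓ) where

  sequencesOfLength : Setoid ℓ ℓ
  sequencesOfLength = ∣ γ ∣ →-setoid A

  ShorterSequence : Set ℓ
  ShorterSequence = Σ[ a ∈ ∣ γ ∣ ] (∣ γ ↓ a ∣ → A)

  cone : ShorterSequence → Subset sequencesOfLength
  cone (a , s) = mkSubset (λ x → ∀ i → x (proj₁ i) ≡ s i)
                          (λ x≗y s⊆x i → trans (sym (x≗y (proj₁ i))) (s⊆x i))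

  boundedTopology : TopologicalSpace ℓ ℓ
  boundedTopology = generatedBy sequencesOfLength cone

record PositivelyTotallyOrderedMonoid (ℓ : Level) : Set (lsuc ℓ) where
  infix  4 _≈_ _≤_
  infixl 6 _+_
  field
    Carrier      : Set ℓ
    _≈_ _≤_      : Rel Carrier ℓ
    _+_          : Carrier → Carrier → Carrier
    0#           : Carrier
    isMonoid     : IsMonoid _≈_ _+_ 0#
    isTotalOrder : IsTotalOrder _≈_ _≤_
    +-mono-≤     : ∀ {a b c d} → a ≤ b → c ≤ d → a + c ≤ b + d
    0-minimum    : ∀ a → 0# ≤ a
    nontrivial   : ¬ (∀ a → a ≈ 0#)

  monoid : Monoid ℓ ℓ
  monoid = record { isMonoid = isMonoid }

  open Monoid monoid public using (rawMonoid) renaming (setoid to ≈-setoid)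
  open RawMonoidDefinitions rawMonoid public using (sum)
  open ToStrict _≈_ _≤_ public using (_<_)

  IsSupremum : ∀ {i} {I : Set i} → (I → Carrier) → Carrier → Set (ℓ ⊔ i)
  IsSupremum f a = (∀ i → f i ≤ a) × (∀ b → (∀ i → f i ≤ b) → a ≤ b)

  IsInfimum : ∀ {i} {I : Set i} → (I → Carrier) → Carrier → Set (ℓ ⊔ i)
  IsInfimum f a = (∀ i → a ≤ f i) × (∀ b → (∀ i → b ≤ f i) → b ≤ a)

record InfinitarySum {ℓ} (𝕊 : PositivelyTotallyOrderedMonoid ℓ) : Set (lsuc (lsuc ℓ)) where
  open PositivelyTotallyOrderedMonoid 𝕊
  field
    partialFunction : PartialFunction (sequences ≈-setoid) ≈-setoid (lsuc ℓ)

  open PartialFunction partialFunction public renaming (apply to Sum)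

  -- `sum` right-associates and ends in 0#, so for nonempty s it equals
  -- s₀ + ⋯ + sₙ.
  field
    Sum-empty  : (s : ∣ finiteOrdinal {ℓ} 0 ∣ → Carrier) →
                 Σ[ p ∈ (finiteOrdinal 0 , s) ∈ dom ] Sum _ p ≈ 0#
    Sum-finite : ∀ n (s : Fin (suc n) → Carrier)
                 (p : (finiteOrdinal (suc n) , s ∘ lower) ∈ dom) → Sum _ p ≈ sum s
    Sum-limit  : ∀ s (p : s ∈ dom) → IsLimit (proj₁ s) →
                 Cofinally (proj₁ s) (λ a → _↾_ ≈-setoid s a ∈ dom) →
                 IsSupremum {I = ∃[ a ] _↾_ ≈-setoid s a ∈ dom} (λ (_ , q) → Sum _ q) (Sum s p)

record WeaklyMeasurable {ℓ o} (T : TopologicalSpace ℓ o) (Λ : Set ℓ)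
                        : Set (lsuc (lsuc ℓ) ⊔ o) where
  open TopologicalSpace T
  field
    𝔐      : Pred (Subset points) (lsuc ℓ)
    𝔐-resp : 𝔐 Respects _≐ˢ_
    𝔐-⋃    : {I : Set ℓ} → I ↣ Λ → (U : I → Subset points) → (∀ i → U i ∈ 𝔐) → ⋃ˢ U ∈ 𝔐
    𝔐-open : ∀ {U} → IsOpen U → U ∈ 𝔐

record Measure {ℓ o} {T : TopologicalSpace ℓ o} {Λ : Set ℓ} (M : WeaklyMeasurable T Λ)
               {𝕊 : PositivelyTotallyOrderedMonoid ℓ} (Σ𝕊 : InfinitarySum 𝕊)
               : Set (lsuc (lsuc ℓ) ⊔ o) where
  open TopologicalSpace T
  open WeaklyMeasurable M
  open PositivelyTotallyOrderedMonoid 𝕊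
  open InfinitarySum Σ𝕊 using (Sum) renaming (dom to dom-Sum)
  field
    partialFunction : PartialFunction (powerset points) ≈-setoid (lsuc ℓ)

  open PartialFunction partialFunction public renaming (apply to μ)

  field
    𝔐⊆dom : ∀ {U} → U ∈ 𝔐 → U ∈ dom

  μ𝔐 : ∀ U → U ∈ 𝔐 → Carrier
  μ𝔐 U m = μ U (𝔐⊆dom m)

  field
    μ-∅         : μ𝔐 emptySubset (𝔐-open open-∅) ≈ 0#
    μ-positive  : 0# < μ𝔐 full (𝔐-open open-full)
    μ-monotone  : ∀ {U V} (m : U ∈ 𝔐) (n : V ∈ 𝔐) → U ⊆ˢ V → μ𝔐 U m ≤ μ𝔐 V n
    μ-additive  : (α : Ordinal ℓ) (α<Λ⁺ : α < Λ ⁺)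
                  (U : ∣ α ∣ → Subset points) (m : ∀ i → U i ∈ 𝔐) →
                  (∀ i j → ¬ (i ≡ j) → Disjoint (U i) (U j)) →
                  Σ[ p ∈ (α , λ i → μ𝔐 (U i) (m i)) ∈ dom-Sum ]
                    μ𝔐 (⋃ˢ U) (𝔐-⋃ α<Λ⁺ U m) ≈ Sum _ p
    μ-singleton : ∀ x (m : ｛ x ｝ˢ ∈ 𝔐) (α : Ordinal ℓ) → α < Λ ⁺ →
                  (U : ∣ α ∣ → Subset points) (b : IsOpenLocalBasis T x U) →
                  IsInfimum (λ i → μ𝔐 (U i) (𝔐-open (proj₁ (proj₁ b i)))) (μ𝔐 ｛ x ｝ˢ m)

-- The family 𝔐 and the measure μ on a given space X; together with X this
-- is a weak λ⁺-measure space.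

record WeakMeasureSpace {ℓ o} (X : TopologicalSpace ℓ o) (Λ : Set ℓ)
                        {𝕊 : PositivelyTotallyOrderedMonoid ℓ} (Σ𝕊 : InfinitarySum 𝕊)
                        : Set (lsuc (lsuc ℓ) ⊔ o) where
  field
    measurable : WeaklyMeasurable X Λ
    measure    : Measure measurable Σ𝕊

  open WeaklyMeasurable measurable public
  open Measure measure public

  Continuous : Set (lsuc ℓ)
  Continuous = ∀ x → Σ[ m ∈ ｛ x ｝ˢ ∈ 𝔐 ] μ𝔐 ｛ x ｝ˢ m ≈ 0#
    where open PositivelyTotallyOrderedMonoid 𝕊

-- Continuity of the sum makes the measure of a disjoint union of at most λ
-- sets the least upper bound of the measures of its finite subunions.  Hence
-- some open C of positive measure is strict: no open subset of C absorbs the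
-- measure of a disjoint open subset of positive measure.  In a strict C only
-- finitely many disjoint open sets can have measure at least ε, for each
-- ε > 0, and an infinite disjoint sequence of open sets of positive measure
-- in C shows that the positive values have countable coinitiality.  So the
-- points of C all of whose neighbourhoods have positive measure are separated
-- by countably many cones; there are at most 2^ℵ₀ ≤ λ of them, and C is null.

module Submission where

open import Level using (Level; _⊔_; Lift; lift; lower) renaming (suc to lsuc)
open import Axiom.ExcludedMiddle using (ExcludedMiddle)
open import Data.Bool.Base using (Bool; T)
open import Data.Bool.Properties using (T-irrelevant)
open import Data.Fin.Base using (Fin; toℕ)
import Data.Fin.Base as Fin
import Data.Fin.Properties as Fin
open import Data.List.Base using (List; []; _∷_; map; length; lookup)
open import Data.List.Relation.Unary.Any using (Any; here; there)
import Data.List.Relation.Unary.Any as Any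
open import Data.List.Relation.Unary.All using (All; []; _∷_)
import Data.List.Relation.Unary.Any.Properties as Any
open import Data.Nat.Base using (ℕ; zero; suc)
import Data.Nat.Base as ℕ
import Data.Nat.Properties as ℕ
open import Data.Product using (Σ; Σ-syntax; ∃; ∃-syntax; _×_; _,_; proj₁; proj₂)
open import Data.Sum.Base using (_⊎_; inj₁; inj₂; [_,_]′)
open import Data.Unit.Polymorphic using (tt)
open import Data.Empty using (⊥-elim)
open import Function using (_∘_; case_of_; _on_; id; _↣_; Injection; mk↣; mk⇔)
open import Induction.WellFounded using (WellFounded; Acc; acc)
import Induction.WellFounded as WellFounded
open import Relation.Binary.Core using (Rel)
open import Relation.Binary.Definitions using (Tri; tri<; tri≈; tri>)
open import Relation.Binary.Bundles using (Setoid)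
open import Relation.Binary.Structures using (IsTotalOrder)
open import Algebra.Bundles using (Monoid)
import Relation.Binary.Construct.On as On
open import Relation.Binary.PropositionalEquality
  using (_≡_; refl; sym; trans; cong; subst; isEquivalence; resp₂; setoid; _→-setoid_)
open import Relation.Nullary using (¬_; Dec; does; yes; no)
open import Relation.Nullary.Decidable using (True; does-⇔; toWitness; fromWitness; decidable-stable)
open import Relation.Unary using (Pred; _∈_; _∉_; _⊆_; _≐_; ∁)
open import Defs

-- Preliminaries on ordinals, injections and enumerations.

module _ {ℓ} (α : Ordinal ℓ) where
  open Ordinal α

  IsLeast : ∀ {p} → Pred ∣ α ∣ p → Pred ∣ α ∣ (ℓ ⊔ p)
  IsLeast P a = P a × (∀ b → b < a → ¬ P b)

module _ {ℓ} {α : Ordinal ℓ} where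
  open Ordinal α

  <-≮-trans : ∀ {i a b} → i < a → ¬ (b < a) → i < b
  <-≮-trans {a = a} {b} i<a b≮a with compare a b
  ... | tri< a<b _ _  = <-trans i<a a<b
  ... | tri≈ _ refl _ = i<a
  ... | tri> _ _ b<a  = ⊥-elim (b≮a b<a)

  upper-bound : ∀ a b → ∃[ c ] ¬ (c < a) × ¬ (c < b)
  upper-bound a b with compare a b
  ... | tri< _ _ b≮a  = b , b≮a , <-irrefl refl
  ... | tri≈ _ refl _ = a , <-irrefl refl , <-irrefl refl
  ... | tri> a≮b _ _  = a , <-irrefl refl , a≮b

  least-unique : ∀ {p} {P : Pred ∣ α ∣ p} {a b} → IsLeast α P a → IsLeast α P b → a ≡ b
  least-unique {a = a} {b} (Pa , a-least) (Pb , b-least) with compare a b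
  ... | tri< a<b _ _ = ⊥-elim (b-least a a<b Pa)
  ... | tri≈ _ a≡b _ = a≡b
  ... | tri> _ _ b<a = ⊥-elim (a-least b b<a Pb)

pullback : ∀ {ℓ} (α : Ordinal ℓ) {I : Set ℓ} → I ↣ ∣ α ∣ → Ordinal ℓ
pullback α {I} f = record
  { Carrier = I
  ; _<_ = _<_ on to
  ; isStrictTotalOrder = record
    { isStrictPartialOrder = record
      { isEquivalence = isEquivalence
      ; irrefl   = λ { refl → <-irrefl refl }
      ; trans    = <-trans
      ; <-resp-≈ = resp₂ (_<_ on to)
      }
    ; compare = cmp
    }
  ; <-irrelevant  = <-irrelevant
  ; <-wellFounded = On.wellFounded to <-wellFounded
  }
  where
  open Ordinal α
  open Injection f using (to; injective)
  cmp : ∀ x y → Tri (to x < to y) (x ≡ y) (to y < to x)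
  cmp x y with compare (to x) (to y)
  ... | tri< p q r = tri< p (q ∘ cong to) r
  ... | tri≈ p q r = tri≈ p (injective q) r
  ... | tri> p q r = tri> p (q ∘ cong to) r

proj₁-↣ : ∀ {ℓ} (α : Ordinal ℓ) (a : ∣ α ∣) → ∣ α ↓ a ∣ ↣ ∣ α ∣
proj₁-↣ α a = mk↣ {to = proj₁} λ { {i , p} {_ , q} refl → cong (i ,_) (Ordinal.<-irrelevant α p q) }

↣-trans : ∀ {a b c} {A : Set a} {B : Set b} {C : Set c} → A ↣ B → B ↣ C → A ↣ C
↣-trans f g = mk↣ (Injection.injective f ∘ Injection.injective g)

-- Cantor's enumeration of ℕ × ℕ along the antidiagonals.

unpair : ℕ → ℕ × ℕ
unpair zero = 0 , 0
unpair (suc n) with unpair n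
... | zero , b  = suc b , 0
... | suc a , b = a , suc b

unpair-surjective : ∀ a b → ∃[ n ] unpair n ≡ (a , b)
unpair-surjective a b = antidiagonal b a (axis (b ℕ.+ a))
  where
  antidiagonal : ∀ b a → ∃[ n ] unpair n ≡ (b ℕ.+ a , 0) → ∃[ n ] unpair n ≡ (a , b)
  antidiagonal zero a start = start
  antidiagonal (suc b) a (n , eq)
    with (m , eq′) ← antidiagonal b (suc a) (n , trans eq (cong (_, 0) (sym (ℕ.+-suc b a))))
    = suc m , step m eq′
    where
    step : ∀ m {a b} → unpair m ≡ (suc a , b) → unpair (suc m) ≡ (a , suc b)
    step m eq rewrite eq = refl
  axis : ∀ s → ∃[ n ] unpair n ≡ (s , 0)
  axis zero = 0 , refl
  axis (suc s)
    with (m , eq) ← antidiagonal s 0 (subst (λ t → ∃[ n ] unpair n ≡ (t , 0)) (sym (ℕ.+-identityʳ s)) (axis s))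
    = suc m , step m eq
    where
    step : ∀ m {b} → unpair m ≡ (0 , b) → unpair (suc m) ≡ (suc b , 0)
    step m eq rewrite eq = refl

unpair³ : ℕ → ℕ × ℕ × ℕ
unpair³ t = let (n , s) = unpair t in n , unpair s

unpair³-surjective : ∀ p → ∃[ t ] unpair³ t ≡ p
unpair³-surjective (n , m , k) =
  let (s , eq) = unpair-surjective m k
      (t , eq′) = unpair-surjective n s
  in t , trans (cong (λ (n , s) → n , unpair s) eq′) (cong (n ,_) eq)

does-reflects : ∀ {p q} {P : Set p} {Q : Set q} (P? : Dec P) (Q? : Dec Q) → does P? ≡ does Q? → P → Q
does-reflects _ (yes q) _ _      = q
does-reflects (no ¬p) (no _) _ p = ⊥-elim (¬p p)

-- Consequences of excluded middle, and the well-ordering theorem.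

module _ (em : ∀ {a : Level} → ExcludedMiddle a) where

  dne : ∀ {p} {P : Set p} → ¬ ¬ P → P
  dne = decidable-stable em

  least-exists : ∀ {ℓ} (α : Ordinal ℓ) {p} (P : Pred ∣ α ∣ p) → ∃ P → ∃ (IsLeast α P)
  least-exists α P (a , Pa) = dne λ none →
    WellFounded.All.wfRec (Ordinal.<-wellFounded α) _ (λ a → ¬ P a)
      (λ b ih Pb → none (b , Pb , λ c c<b → ih c<b)) a Pa

  -- Excluded middle moves a proposition to any universe, so that a union over a collection of
  -- subsets of `A` is again a `Pred A ℓ`. Proofs of `True` are unique, which `<-irrelevant` will
  -- require.
  Resized : ∀ {p} ℓ → Set p → Set ℓ
  Resized ℓ P = Lift ℓ (True (em {P = P}))

  resize : ∀ {p ℓ} {P : Set p} → P → Resized ℓ P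
  resize = lift ∘ fromWitness

  unresize : ∀ {p ℓ} {P : Set p} → Resized ℓ P → P
  unresize = toWitness ∘ lower

  Resized-irrelevant : ∀ {p ℓ} {P : Set p} (r s : Resized ℓ P) → r ≡ s
  Resized-irrelevant (lift r) (lift s) = cong lift (T-irrelevant r s)

  -- If no finite list covers, choosing again and again an element not covered by the previous
  -- choices produces the forbidden infinite sequence.
  finite-cover : ∀ {p r} {P : Set p} (R : P → P → Set r) →
    (∀ (f : ℕ → P) → ¬ (∀ i j → i ℕ.< j → ¬ R (f i) (f j))) → ∃[ ps ] ∀ p → Any (λ q → R q p) ps
  finite-cover {P = P} R no-infinite = dne λ none →
    let new : ∀ ps → ∃[ p ] ¬ Any (λ q → R q p) ps
        new ps = dne λ all-covered → none (ps , λ p → dne λ uncovered → all-covered (p , uncovered))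
    in no-infinite (proj₁ ∘ new ∘ prefix new) λ i j i<j r →
         proj₂ (new (prefix new j)) (earlier new (λ q → R q _) (ℕ.≤⇒≤′ i<j) r)
    where
    module _ (new : ∀ ps → ∃[ p ] ¬ Any (λ q → R q p) ps) where
      prefix : ℕ → List P
      prefix zero    = []
      prefix (suc n) = proj₁ (new (prefix n)) ∷ prefix n

      earlier : ∀ {q} (Q : Pred P q) {i j} → suc i ℕ.≤′ j →
                Q (proj₁ (new (prefix i))) → Any Q (prefix j)
      earlier Q (ℕ.≤′-reflexive refl) = here
      earlier Q (ℕ.≤′-step i<j)       = there ∘ earlier Q i<j

  -- Zermelo's theorem.  The towers are linearly ordered by inclusion, and
  -- every x is the element chosen next after the largest tower avoiding x.

  module _ {ℓ} {A : Set ℓ} (choose : (P : Pred A ℓ) → ∃ P → A)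
           (choose-∈ : ∀ P (p : ∃ P) → choose P p ∈ P)
           (choose-cong : ∀ P Q (p : ∃ P) (q : ∃ Q) → P ≐ Q → choose P p ≡ choose Q q) where

    next : Pred A ℓ → Pred A ℓ
    next S x = x ∈ S ⊎ Σ[ p ∈ ∃ (∁ S) ] x ≡ choose (∁ S) p

    ⋃ : (Pred A ℓ → Set ℓ) → Pred A ℓ
    ⋃ F x = Resized ℓ (∃[ S ] F S × x ∈ S)

    data Tower : Pred A ℓ → Set (lsuc ℓ) where
      next-tower : ∀ {S} → Tower S → Tower (next S)
      ⋃-tower    : ∀ {F} → (∀ S → F S → Tower S) → Tower (⋃ F)

    next-cong : ∀ {S T} → S ≐ T → next S ⊆ next T
    next-cong (S⊆T , T⊆S) (inj₁ x∈S) = inj₁ (S⊆T x∈S)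
    next-cong (S⊆T , T⊆S) (inj₂ ((y , y∉S) , x≡)) =
      inj₂ ((y , y∉S ∘ T⊆S) , trans x≡ (choose-cong _ _ _ _ ((_∘ T⊆S) , (_∘ S⊆T))))

    -- `next S` has at most one element more than `S`, so a `T` in between is one of the two.
    next-squeeze : ∀ {S T} → S ⊆ T → T ⊆ next S → next S ⊆ T ⊎ next T ⊆ next S
    next-squeeze {S} {T} S⊆T T⊆S⁺ with em {P = ∃[ x ] x ∈ T × x ∉ S}
    ... | no none = inj₂ (next-cong ((λ x∈T → dne λ x∉S → none (_ , x∈T , x∉S)) , S⊆T))
    ... | yes (x , x∈T , x∉S) with T⊆S⁺ x∈T
    ...   | inj₁ x∈S = ⊥-elim (x∉S x∈S)
    ...   | inj₂ (p , refl) = inj₁ λ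
      { (inj₁ y∈S) → S⊆T y∈S
      ; (inj₂ (q , refl)) → subst T (choose-cong _ _ p q (id , id)) x∈T }

    -- Outer induction on `S`, and for successors an inner induction on `T`: as soon as `T ⊆ next S`
    -- is known, the outer hypothesis compares `S` with `T`, and its first case is `next-squeeze`.
    tower-linear : ∀ {S T} → Tower S → Tower T → S ⊆ T ⊎ next T ⊆ S
    tower-linear {T = T} (⋃-tower {F} h) t with em {P = ∃[ S ] F S × next T ⊆ S}
    ... | yes (S , FS , T⁺⊆S) = inj₂ λ x∈ → resize (S , FS , T⁺⊆S x∈)
    ... | no none = inj₁ λ x∈ → let (S , FS , x∈S) = unresize x∈ in
      case tower-linear (h S FS) t of λ
        { (inj₁ S⊆T) → S⊆T x∈S ; (inj₂ T⁺⊆S) → ⊥-elim (none (S , FS , T⁺⊆S)) }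
    tower-linear {T = T} (next-tower {S} s) t = go t
      where
      comparable : ∀ {T} → Tower T → T ⊆ next S → next S ⊆ T ⊎ next T ⊆ next S
      comparable t T⊆S⁺ with tower-linear s t
      ... | inj₁ S⊆T  = next-squeeze S⊆T T⊆S⁺
      ... | inj₂ T⁺⊆S = inj₂ (inj₁ ∘ T⁺⊆S)
      go : ∀ {T} → Tower T → next S ⊆ T ⊎ next T ⊆ next S
      go t@(next-tower t′) with go t′
      ... | inj₁ S⁺⊆T = inj₁ (inj₁ ∘ S⁺⊆T)
      ... | inj₂ T⊆S⁺ = comparable t T⊆S⁺
      go t@(⋃-tower {F} h) with em {P = ∃[ T ] F T × next S ⊆ T}
      ... | yes (T , FT , S⁺⊆T) = inj₁ λ x∈ → resize (T , FT , S⁺⊆T x∈)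
      ... | no none = comparable t λ x∈ → let (T , FT , x∈T) = unresize x∈ in
        case go (h T FT) of λ
          { (inj₁ S⁺⊆T) → ⊥-elim (none (T , FT , S⁺⊆T)) ; (inj₂ T⁺⊆S⁺) → T⁺⊆S⁺ (inj₁ x∈T) }

    Below : A → Pred A ℓ
    Below x = ⋃ λ S → Resized ℓ (Tower S × x ∉ S)

    Below-tower : ∀ x → Tower (Below x)
    Below-tower x = ⋃-tower λ S r → proj₁ (unresize r)

    x∉Below : ∀ {x} → x ∉ Below x
    x∉Below x∈ = let (S , r , x∈S) = unresize x∈ in proj₂ (unresize r) x∈S

    Below-maximal : ∀ {S x} → Tower S → x ∉ S → S ⊆ Below x
    Below-maximal t x∉S y∈S = resize (_ , resize (t , x∉S) , y∈S)

    x∈next-Below : ∀ x → x ∈ next (Below x)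
    x∈next-Below x = dne λ x∉ →
      let p : ∃ (∁ (Below x))
          p = x , x∉Below
      in
      -- If `next (Below x)` avoided `x`, it would be included in `Below x`, although the chosen
      -- element lies outside.
      choose-∈ _ p (Below-maximal (next-tower (Below-tower x)) x∉ (inj₂ (p , refl)))

    Below-injective : ∀ {x y} → Below x ≐ Below y → x ≡ y
    Below-injective {x} {y} e with x∈next-Below x | x∈next-Below y
    ... | inj₁ x∈ | _ = ⊥-elim (x∉Below x∈)
    ... | _ | inj₁ y∈ = ⊥-elim (x∉Below y∈)
    ... | inj₂ (_ , x≡) | inj₂ (_ , y≡) =
      trans x≡ (trans (choose-cong _ _ _ _ ((_∘ proj₂ e) , (_∘ proj₁ e))) (sym y≡))

    Below-⊆ : ∀ {x y} → y ∈ Below x → next (Below y) ⊆ Below x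
    Below-⊆ {x} {y} y∈ with tower-linear (Below-tower x) (Below-tower y)
    ... | inj₁ x⊆y = ⊥-elim (x∉Below (x⊆y y∈))
    ... | inj₂ y⁺⊆x = y⁺⊆x

    Below-trans : ∀ {x y z} → z ∈ Below y → y ∈ Below x → z ∈ Below x
    Below-trans z∈ y∈ = Below-⊆ y∈ (inj₁ z∈)

    Below-compare : ∀ x y → Tri (x ∈ Below y) (x ≡ y) (y ∈ Below x)
    Below-compare x y with em {P = x ∈ Below y} | em {P = y ∈ Below x}
    ... | yes x∈ | _ = tri< x∈ (λ { refl → x∉Below x∈ }) (x∉Below ∘ Below-trans x∈)
    ... | no x∉ | yes y∈ = tri> x∉ (λ { refl → x∉Below y∈ }) y∈
    ... | no x∉ | no y∉ =
      tri≈ x∉ (Below-injective (Below-maximal (Below-tower x) y∉ , Below-maximal (Below-tower y) x∉)) y∉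

    -- Induction on a tower containing `x`. If `x` is the element added to `S`, then by linearity
    -- everything below `x` already belongs to `S`.
    Below-wellFounded : WellFounded (λ y x → y ∈ Below x)
    Below-wellFounded x = go (next-tower (Below-tower x)) (x∈next-Below x)
      where
      go : ∀ {S x} → Tower S → x ∈ S → Acc (λ y x → y ∈ Below x) x
      go (⋃-tower h) x∈ = let (S , FS , x∈S) = unresize x∈ in go (h S FS) x∈S
      go (next-tower s) (inj₁ x∈S) = go s x∈S
      go {x = x} (next-tower {S} s) (inj₂ (p , refl)) = acc λ y∈ → go s
        (case tower-linear (Below-tower x) s of λ
          { (inj₁ below⊆S) → below⊆S y∈
          ; (inj₂ S⁺⊆below) → ⊥-elim (x∉Below (S⁺⊆below (inj₂ (p , refl)))) })

    wellOrder : Ordinal ℓ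
    wellOrder = record
      { Carrier = A
      ; _<_ = λ y x → y ∈ Below x
      ; isStrictTotalOrder = record
        { isStrictPartialOrder = record
          { isEquivalence = isEquivalence
          ; irrefl   = λ { refl x∈ → x∉Below x∈ }
          ; trans    = Below-trans
          ; <-resp-≈ = resp₂ (λ y x → y ∈ Below x)
          }
        ; compare = Below-compare
        }
      ; <-irrelevant  = Resized-irrelevant
      ; <-wellFounded = Below-wellFounded
      }

-- Measures of disjoint unions and of their finite subunions.

module MeasureProperties
         (em : ∀ {a : Level} → ExcludedMiddle a)
         {ℓ o} {T : TopologicalSpace ℓ o} (Λ : Ordinal ℓ) (ω↣Λ : Lift ℓ ℕ ↣ ∣ Λ ∣)
         {𝕊 : PositivelyTotallyOrderedMonoid ℓ} {Σ𝕊 : InfinitarySum 𝕊}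
         (M : WeakMeasureSpace T ∣ Λ ∣ Σ𝕊) where
  open TopologicalSpace T
  open PositivelyTotallyOrderedMonoid 𝕊
  open IsTotalOrder isTotalOrder using ()
    renaming (refl to ≤-refl; trans to ≤-trans; reflexive to ≤-reflexive; module Eq to ≈)
  open InfinitarySum Σ𝕊 using (Sum-finite; Sum-limit; Sum; apply-cong) renaming (dom to dom-Sum)
  open WeakMeasureSpace M hiding (apply-cong)

  MeasurableSet : Set (lsuc ℓ)
  MeasurableSet = Σ[ U ∈ Subset points ] U ∈ 𝔐

  infix 4 _∈ᵐ_ _⊆ᵐ_
  _∈ᵐ_ : Point → MeasurableSet → Set ℓ
  x ∈ᵐ U = x ∈ˢ proj₁ U

  _⊆ᵐ_ : Rel MeasurableSet ℓ
  U ⊆ᵐ V = proj₁ U ⊆ˢ proj₁ V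

  ν : MeasurableSet → Carrier
  ν (U , m) = μ𝔐 U m

  ν-mono : ∀ {U V} → U ⊆ᵐ V → ν U ≤ ν V
  ν-mono {_ , m} {_ , n} = μ-monotone m n

  ⋃ᵐ : {I : Set ℓ} → I ↣ ∣ Λ ∣ → (I → MeasurableSet) → MeasurableSet
  ⋃ᵐ e U = ⋃ˢ (proj₁ ∘ U) , 𝔐-⋃ e (proj₁ ∘ U) (proj₂ ∘ U)

  PairwiseDisjoint : {I : Set ℓ} → (I → MeasurableSet) → Set ℓ
  PairwiseDisjoint U = ∀ i j → ¬ (i ≡ j) → Disjoint (proj₁ (U i)) (proj₁ (U j))

  ν-⋃ : (α : Ordinal ℓ) (e : α < ∣ Λ ∣ ⁺) (U : ∣ α ∣ → MeasurableSet) → PairwiseDisjoint U →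
        Σ[ p ∈ (α , ν ∘ U) ∈ dom-Sum ] ν (⋃ᵐ e U) ≈ Sum _ p
  ν-⋃ α e U = μ-additive α e (proj₁ ∘ U) (proj₂ ∘ U)

  private
    2↣Λ : Lift ℓ (Fin 2) ↣ ∣ Λ ∣
    2↣Λ = ↣-trans (mk↣ λ p → cong lift (Fin.toℕ-injective (cong lower p))) ω↣Λ

    pair : MeasurableSet → MeasurableSet → Fin 2 → MeasurableSet
    pair U V Fin.zero    = U
    pair U V (Fin.suc _) = V

  infixl 6 _∪ᵐ_
  _∪ᵐ_ : MeasurableSet → MeasurableSet → MeasurableSet
  U ∪ᵐ V = ⋃ᵐ 2↣Λ (pair U V ∘ lower)

  ∪-left : ∀ {U V x} → x ∈ᵐ U → x ∈ᵐ U ∪ᵐ V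
  ∪-left x∈U = lift Fin.zero , x∈U

  ∪-right : ∀ {U V x} → x ∈ᵐ V → x ∈ᵐ U ∪ᵐ V
  ∪-right x∈V = lift (Fin.suc Fin.zero) , x∈V

  ∪-case : ∀ {U V x} → x ∈ᵐ U ∪ᵐ V → x ∈ᵐ U ⊎ x ∈ᵐ V
  ∪-case (lift Fin.zero , x∈U)             = inj₁ x∈U
  ∪-case (lift (Fin.suc Fin.zero) , x∈V) = inj₂ x∈V

  ν-∪ : ∀ U V → Disjoint (proj₁ U) (proj₁ V) → ν (U ∪ᵐ V) ≈ ν U + ν V
  ν-∪ U V disj =
    let (p , eq) = ν-⋃ (finiteOrdinal 2) 2↣Λ (pair U V ∘ lower) pairwise
    in ≈.trans eq (≈.trans (Sum-finite 1 (ν ∘ pair U V) p) (∙-congˡ (identityʳ _)))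
    where
    open Monoid monoid using (∙-congˡ; identityʳ)
    pairwise : PairwiseDisjoint (pair U V ∘ lower)
    pairwise (lift Fin.zero) (lift Fin.zero) i≢j _ = i≢j refl
    pairwise (lift Fin.zero) (lift (Fin.suc Fin.zero)) _ = disj
    pairwise (lift (Fin.suc Fin.zero)) (lift Fin.zero) _ (x∈V , x∈U) = disj (x∈U , x∈V)
    pairwise (lift (Fin.suc Fin.zero)) (lift (Fin.suc Fin.zero)) i≢j _ = i≢j refl

  ν-split-≤ : ∀ {W} U V → Disjoint (proj₁ U) (proj₁ V) → (∀ {x} → x ∈ᵐ W → x ∈ᵐ U ⊎ x ∈ᵐ V) →
              ν W ≤ ν U + ν V
  ν-split-≤ {W} U V disj split = ≤-trans
    (ν-mono {W} {U ∪ᵐ V} λ x∈W → [ ∪-left {U} {V} , ∪-right {U} {V} ]′ (split x∈W))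
    (≤-reflexive (ν-∪ U V disj))

  ν-disjoint-≤ : ∀ {W} U V → Disjoint (proj₁ U) (proj₁ V) → U ⊆ᵐ W → V ⊆ᵐ W → ν U + ν V ≤ ν W
  ν-disjoint-≤ {W} U V disj U⊆W V⊆W = ≤-trans (≤-reflexive (≈.sym (ν-∪ U V disj)))
    (ν-mono {U ∪ᵐ V} {W} λ x∈ → [ U⊆W , V⊆W ]′ (∪-case {U} {V} x∈))

  -- The bound is imposed on every measurable set covered by finitely many `U i`, so that unions
  -- along lists, with possible repetitions, need not be formed.
  FinitelyBounded : {I : Set ℓ} → (I → MeasurableSet) → Carrier → Set (lsuc ℓ)
  FinitelyBounded {I} U b = (is : List I) (V : MeasurableSet) →
    (∀ {x} → x ∈ᵐ V → Any (λ i → x ∈ᵐ U i) is) → ν V ≤ b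

  FiniteSubunionsSuffice : Set ℓ → Set (lsuc ℓ)
  FiniteSubunionsSuffice I = (e : I ↣ ∣ Λ ∣) (U : I → MeasurableSet) → PairwiseDisjoint U →
    ∀ b → FinitelyBounded U b → ν (⋃ᵐ e U) ≤ b

  -- A last set U m is merged into some earlier U z, so that only limit
  -- lengths need continuity of the sum.
  finiteSubunionsSuffice-step : (α : Ordinal ℓ) → (∀ i → FiniteSubunionsSuffice ∣ α ↓ i ∣) →
                                FiniteSubunionsSuffice ∣ α ∣
  finiteSubunionsSuffice-step α ih e U disj b bounded = byCases em em
    where
    module α = Ordinal α

    e↓ : ∀ i → ∣ α ↓ i ∣ ↣ ∣ Λ ∣
    e↓ i = ↣-trans (proj₁-↣ α i) e

    disj↓ : ∀ i → PairwiseDisjoint {∣ α ↓ i ∣} (U ∘ proj₁)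
    disj↓ i j k j≢k = disj _ _ (j≢k ∘ Injection.injective (proj₁-↣ α i))

    initial-≤ : ∀ i → ν (⋃ᵐ (e↓ i) (U ∘ proj₁)) ≤ b
    initial-≤ i = ih i (e↓ i) (U ∘ proj₁) (disj↓ i) b
      λ is V V⊆ → bounded (map proj₁ is) V (Any.map⁺ ∘ V⊆)

    limit : IsLimit α → ν (⋃ᵐ e U) ≤ b
    limit lim =
      let (p , eq) = ν-⋃ α e U disj
          -- Additivity puts every initial segment into the domain of the sum, so each `i` is its
          -- own cofinal witness.
          (_ , sup) = Sum-limit _ p lim λ i →
            i , α.<-irrefl refl , proj₁ (ν-⋃ (α ↓ i) (e↓ i) (U ∘ proj₁) (disj↓ i))
      in ≤-trans (≤-reflexive eq) (sup b λ (i , q) →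
           let (p′ , eq′) = ν-⋃ (α ↓ i) (e↓ i) (U ∘ proj₁) (disj↓ i)
           in ≤-trans
                (≤-reflexive (≈.trans (apply-cong q p′ (Setoid.refl (sequences ≈-setoid))) (≈.sym eq′)))
                (initial-≤ i))

    module _ (m : ∣ α ∣) (m-last : ∀ j → ¬ (m α.< j)) where

      singleton : ¬ ∃ (λ z → z α.< m) → ν (⋃ᵐ e U) ≤ b
      singleton m-first = bounded (m ∷ []) (⋃ᵐ e U) λ { {x} (i , x∈) → here (only i x∈) }
        where
        only : ∀ i {x} → x ∈ᵐ U i → x ∈ᵐ U m
        only i x∈ with α.compare i m
        ... | tri< i<m _ _  = ⊥-elim (m-first (i , i<m))
        ... | tri≈ _ refl _ = x∈
        ... | tri> _ _ m<i  = ⊥-elim (m-last i m<i)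

      merged : ∃ (λ z → z α.< m) → ν (⋃ᵐ e U) ≤ b
      merged (z , z<m) = ≤-trans (ν-mono {⋃ᵐ e U} {⋃ᵐ (e↓ m) U′} λ { {x} (i , x∈) → cover i x∈ })
        -- One `m` in front of the list takes care of the points that the merged set has from `U m`.
        (ih m (e↓ m) U′ disj′ b λ is V V⊆ → bounded (m ∷ map proj₁ is) V (cover-list is ∘ V⊆))
        where
        U′ : ∣ α ↓ m ∣ → MeasurableSet
        U′ (i , _) with em {P = i ≡ z}
        ... | yes _ = U i ∪ᵐ U m
        ... | no _  = U i

        ∈U′ : ∀ i {x} → x ∈ᵐ U (proj₁ i) → x ∈ᵐ U′ i
        ∈U′ (i , _) x∈ with em {P = i ≡ z}
        ... | yes _ = ∪-left {U i} {U m} x∈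
        ... | no _  = x∈

        m∈U′ : ∀ {x} → x ∈ᵐ U m → x ∈ᵐ U′ (z , z<m)
        m∈U′ x∈ with em {P = z ≡ z}
        ... | yes _  = ∪-right {U z} {U m} x∈
        ... | no z≢z = ⊥-elim (z≢z refl)

        U′-case : ∀ i {x} → x ∈ᵐ U′ i → x ∈ᵐ U (proj₁ i) ⊎ (proj₁ i ≡ z × x ∈ᵐ U m)
        U′-case (i , _) x∈ with em {P = i ≡ z}
        ... | no _  = inj₁ x∈
        ... | yes i≡z with ∪-case {U i} {U m} x∈
        ...   | inj₁ x∈i = inj₁ x∈i
        ...   | inj₂ x∈m = inj₂ (i≡z , x∈m)

        <m-disjoint : ∀ i → i α.< m → Disjoint (proj₁ (U i)) (proj₁ (U m))
        <m-disjoint i i<m = disj i m λ { refl → α.<-irrefl refl i<m }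

        disj′ : PairwiseDisjoint U′
        disj′ i j i≢j (x∈i , x∈j) with U′-case i x∈i | U′-case j x∈j
        ... | inj₁ x∈i | inj₁ x∈j = disj↓ m i j i≢j (x∈i , x∈j)
        ... | inj₁ x∈i | inj₂ (_ , x∈m) = <m-disjoint _ (proj₂ i) (x∈i , x∈m)
        ... | inj₂ (_ , x∈m) | inj₁ x∈j = <m-disjoint _ (proj₂ j) (x∈j , x∈m)
        ... | inj₂ (refl , _) | inj₂ (refl , _) = i≢j (cong (z ,_) (α.<-irrelevant _ _))

        cover : ∀ i {x} → x ∈ᵐ U i → x ∈ᵐ ⋃ᵐ (e↓ m) U′
        cover i x∈ with α.compare i m
        ... | tri< i<m _ _  = (i , i<m) , ∈U′ _ x∈
        ... | tri≈ _ refl _ = (z , z<m) , m∈U′ x∈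
        ... | tri> _ _ m<i  = ⊥-elim (m-last i m<i)

        cover-list : ∀ is {x} → Any (λ i → x ∈ᵐ U′ i) is → Any (λ i → x ∈ᵐ U i) (m ∷ map proj₁ is)
        cover-list (i ∷ is) (here x∈) with U′-case i x∈
        ... | inj₁ x∈i       = there (here x∈i)
        ... | inj₂ (_ , x∈m) = here x∈m
        cover-list (i ∷ is) (there x∈) with cover-list is x∈
        ... | here x∈m = here x∈m
        ... | there x∈ = there (there x∈)

    byCases : Dec ∣ α ∣ → Dec (∃[ m ] ∀ j → ¬ (m α.< j)) → ν (⋃ᵐ e U) ≤ b
    byCases (no empty) _ = bounded [] (⋃ᵐ e U) λ { (i , _) → ⊥-elim (empty i) }
    byCases (yes i) (no no-last) = limit (i , λ m → dne em λ none → no-last (m , λ j m<j → none (j , m<j)))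
    byCases (yes _) (yes (m , m-last)) with em {P = ∃ (λ z → z α.< m)}
    ... | yes earlier = merged m m-last earlier
    ... | no m-first  = singleton m m-last m-first

  -- The index set is ordered through its injection into `Λ`. The induction runs over strict upper
  -- bounds of the image in `Λ`: the segment below `i` is bounded by the image of `i`. The whole
  -- image may be unbounded, hence one more step outside the recursion.
  finiteSubunionsSuffice : ∀ {I} → FiniteSubunionsSuffice I
  finiteSubunionsSuffice e =
    finiteSubunionsSuffice-step (pullback Λ e)
      (λ i → below (to e i) (↣-trans (proj₁-↣ (pullback Λ e) i) e) proj₂) e
    where
    open Injection using (to)
    open Ordinal Λ using () renaming (_<_ to _<Λ_; <-wellFounded to <Λ-wellFounded)
    below : ∀ a {I} (e : I ↣ ∣ Λ ∣) → (∀ i → to e i <Λ a) → FiniteSubunionsSuffice I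
    below = WellFounded.All.wfRec <Λ-wellFounded _
      (λ a → ∀ {I} (e : I ↣ ∣ Λ ∣) → (∀ i → to e i <Λ a) → FiniteSubunionsSuffice I)
      λ a ih e e<a → finiteSubunionsSuffice-step (pullback Λ e)
        λ i → ih (e<a i) (↣-trans (proj₁-↣ (pullback Λ e) i) e) proj₂

-- The space `X`: cones, open sets and null sets.

module _ (em : ∀ {a : Level} → ExcludedMiddle a)
         {ℓ} {γ : Ordinal ℓ} (γ₀ : ∣ γ ∣) {A : Set ℓ} {X : Subset (sequencesOfLength γ A)}
         (Λ : Ordinal ℓ) (ω↣Λ : Lift ℓ ℕ ↣ ∣ Λ ∣)
         (B : ∣ Λ ∣ → Subset (subsetSetoid X)) (basis : IsBasis (subspace (boundedTopology γ A) X) B)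
         {𝕊 : PositivelyTotallyOrderedMonoid ℓ} {Σ𝕊 : InfinitarySum 𝕊}
         (M : WeakMeasureSpace (subspace (boundedTopology γ A) X) ∣ Λ ∣ Σ𝕊)
         (continuous : WeakMeasureSpace.Continuous M) where
  open Ordinal γ using (_<_; <-trans; <-irrefl)
  open TopologicalSpace (subspace (boundedTopology γ A) X)
  open PositivelyTotallyOrderedMonoid 𝕊 hiding (_<_)
  open IsTotalOrder isTotalOrder using ()
    renaming (refl to ≤-refl; trans to ≤-trans; reflexive to ≤-reflexive;
              total to ≤-total; antisym to ≤-antisym)
  open Monoid monoid using (identityˡ)
  open WeakMeasureSpace M hiding (apply-cong)
  open MeasureProperties em Λ ω↣Λ M

  ≰⇒≥ : ∀ {a b} → ¬ (a ≤ b) → b ≤ a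
  ≰⇒≥ {a} {b} a≰b = [ ⊥-elim ∘ a≰b , id ]′ (≤-total a b)

  -- The trace on `X` of the cone over the restriction of `x` to `a`. Only cones that meet `X` arise
  -- in this way.
  cone-at : Point → ∣ γ ∣ → Subset points
  cone-at x a = mkSubset (λ y → ∀ i → i < a → proj₁ y i ≡ proj₁ x i)
                         (λ y≈z y∈ i i<a → trans (sym (y≈z i)) (y∈ i i<a))

  cone-refl : ∀ x a → x ∈ˢ cone-at x a
  cone-refl _ _ _ _ = refl

  cone-sym : ∀ {x y a} → y ∈ˢ cone-at x a → x ∈ˢ cone-at y a
  cone-sym y∈ i i<a = sym (y∈ i i<a)

  cone-trans : ∀ {x y z a} → z ∈ˢ cone-at y a → y ∈ˢ cone-at x a → z ∈ˢ cone-at x a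
  cone-trans z∈ y∈ i i<a = trans (z∈ i i<a) (y∈ i i<a)

  cone-anti : ∀ {x a b} → ¬ (b < a) → cone-at x b ⊆ˢ cone-at x a
  cone-anti b≮a y∈ i i<a = y∈ i (<-≮-trans {α = γ} i<a b≮a)

  -- Cones at one point are nested, so a single cone replaces the finite intersections of the
  -- generated topology. This form lies in `Set ℓ`, while `IsOpen` quantifies over ambient subsets.
  Open : Subset points → Set ℓ
  Open U = ∀ x → x ∈ˢ U → ∃[ a ] cone-at x a ⊆ˢ U

  abstract
    Open⇒IsOpen : ∀ V → Open V → IsOpen V
    Open⇒IsOpen V o =
      ⋃ˢ cones ,
      TopologicalSpace.open-⋃ (boundedTopology γ A) cones
        (λ _ y y∈ → _ ∷ [] , y∈ ∷ [] , λ { z (z∈ ∷ []) → z∈ }) ,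
      (λ {x} x∈V → (x , x∈V) , λ _ → refl) ,
      λ { {y} ((x , x∈V) , y∈) → proj₂ (o x x∈V) λ i i<a → y∈ (i , i<a) }
      where
      cones : (∃[ x ] x ∈ˢ V) → Subset (sequencesOfLength γ A)
      cones (x , x∈V) = cone γ A (proj₁ (o x x∈V) , proj₁ x ∘ proj₁)

    IsOpen⇒Open : ∀ V → IsOpen V → Open V
    IsOpen⇒Open V (U , oU , V⊆U , U⊆V) x x∈V =
      let (is , x∈is , is⊆U) = oU (proj₁ x) (V⊆U x∈V)
          (a , a⊆is) = within is x∈is
      in a , λ {y} y∈ → U⊆V (is⊆U (proj₁ y) (a⊆is y y∈))
      where
      within : ∀ is → All (λ i → proj₁ x ∈ˢ cone γ A i) is →
               ∃[ a ] ∀ y → y ∈ˢ cone-at x a → All (λ i → proj₁ y ∈ˢ cone γ A i) is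
      -- The empty intersection is the whole space; any level serves, and `γ₀` supplies one.
      within [] [] = γ₀ , λ _ _ → []
      within ((b , _) ∷ is) (x∈b ∷ x∈is) =
        let (a , a⊆is) = within is x∈is
            (c , c≮a , c≮b) = upper-bound {α = γ} a b
        in c , λ y y∈ →
          (λ (i , i<b) → trans (cone-anti {x} c≮b {y} y∈ i i<b) (x∈b (i , i<b))) ∷
          a⊆is y (cone-anti {x} c≮a {y} y∈)

  OpenSet : Set (lsuc ℓ)
  OpenSet = Σ (Subset points) Open

  infix 4 _∈ᵒ_ _⊆ᵒ_
  _∈ᵒ_ : Point → OpenSet → Set ℓ
  x ∈ᵒ U = x ∈ˢ proj₁ U

  _⊆ᵒ_ : Rel OpenSet ℓ
  U ⊆ᵒ V = ∀ x → x ∈ᵒ U → x ∈ᵒ V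

  Disjointᵒ : Rel OpenSet ℓ
  Disjointᵒ U V = ∀ x → x ∈ᵒ U → ¬ x ∈ᵒ V

  measurableᵒ : OpenSet → MeasurableSet
  measurableᵒ (U , o) = U , 𝔐-open (Open⇒IsOpen U o)

  νᵒ : OpenSet → Carrier
  νᵒ U = ν (measurableᵒ U)

  νᵒ-mono : ∀ U V → U ⊆ᵒ V → νᵒ U ≤ νᵒ V
  νᵒ-mono U V U⊆V = ν-mono {measurableᵒ U} {measurableᵒ V} (U⊆V _)

  νᵒ-split-≤ : ∀ W U V → Disjointᵒ U V → (∀ x → x ∈ᵒ W → x ∈ᵒ U ⊎ x ∈ᵒ V) → νᵒ W ≤ νᵒ U + νᵒ V
  νᵒ-split-≤ W U V disj split =
    ν-split-≤ {measurableᵒ W} (measurableᵒ U) (measurableᵒ V)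
      (λ (x∈U , x∈V) → disj _ x∈U x∈V) (split _)

  νᵒ-disjoint-≤ : ∀ W U V → Disjointᵒ U V → U ⊆ᵒ W → V ⊆ᵒ W → νᵒ U + νᵒ V ≤ νᵒ W
  νᵒ-disjoint-≤ W U V disj U⊆W V⊆W =
    ν-disjoint-≤ {measurableᵒ W} (measurableᵒ U) (measurableᵒ V)
      (λ (x∈U , x∈V) → disj _ x∈U x∈V) (U⊆W _) (V⊆W _)

  fullᵒ : OpenSet
  fullᵒ = full , λ _ _ → γ₀ , λ _ → tt

  ∅ᵒ : OpenSet
  ∅ᵒ = emptySubset , λ { _ (() , _) }

  coneᵒ : Point → ∣ γ ∣ → OpenSet
  coneᵒ x a = cone-at x a , λ y y∈ → a , λ {z} z∈ → cone-trans {x} {y} {z} z∈ y∈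

  ⋃ᵒ : {I : Set ℓ} → (I → OpenSet) → OpenSet
  ⋃ᵒ U = ⋃ˢ (proj₁ ∘ U) , λ { x (i , x∈) →
    let (a , a⊆) = proj₂ (U i) x x∈ in a , λ y∈ → i , a⊆ y∈ }

  _∪ᵒ_ : OpenSet → OpenSet → OpenSet
  U ∪ᵒ V = mkSubset (λ x → x ∈ᵒ U ⊎ x ∈ᵒ V)
             (λ { x≈y (inj₁ x∈) → inj₁ (Subset.resp (proj₁ U) x≈y x∈)
                ; x≈y (inj₂ x∈) → inj₂ (Subset.resp (proj₁ V) x≈y x∈) }) ,
           λ { x (inj₁ x∈) → let (a , a⊆) = proj₂ U x x∈ in a , inj₁ ∘ a⊆
             ; x (inj₂ x∈) → let (a , a⊆) = proj₂ V x x∈ in a , inj₂ ∘ a⊆ }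

  -- The result is open because cones are clopen: if `z` agrees with `y` below `a` and lies in the
  -- cone of `x` at `a`, so does `y`.
  _∖_ : OpenSet → Point × ∣ γ ∣ → OpenSet
  U ∖ (x , a) =
    mkSubset (λ y → y ∈ᵒ U × ¬ y ∈ˢ cone-at x a)
      (λ {y} {z} y≈z (y∈ , y∉) → Subset.resp (proj₁ U) y≈z y∈ ,
        λ z∈ → y∉ (cone-trans {x} {z} {y} (λ i _ → y≈z i) z∈)) ,
    λ y (y∈ , y∉) →
      let (b , b⊆) = proj₂ U y y∈
          (c , c≮a , c≮b) = upper-bound {α = γ} a b
      in c , λ {z} z∈ → b⊆ (cone-anti {y} c≮b {z} z∈) ,
         λ z∈x → y∉ (cone-trans {x} {z} {y} (cone-sym {y} {z} (cone-anti {y} c≮a {z} z∈)) z∈x)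

  νᵒ-∖-≤ : ∀ U V x a → (∀ y → y ∈ᵒ V → ¬ y ∈ˢ cone-at x a → y ∈ᵒ U) →
           νᵒ V ≤ νᵒ (U ∖ (x , a)) + νᵒ (coneᵒ x a)
  νᵒ-∖-≤ U V x a V⊆ = νᵒ-split-≤ V (U ∖ (x , a)) (coneᵒ x a) (λ _ → proj₂) λ y y∈V → split y y∈V em
    where
    split : ∀ y → y ∈ᵒ V → Dec (y ∈ˢ cone-at x a) → y ∈ᵒ (U ∖ (x , a)) ⊎ y ∈ˢ cone-at x a
    split y y∈V (yes y∈) = inj₂ y∈
    split y y∈V (no y∉)  = inj₁ (V⊆ y y∈V y∉ , y∉)

  -- Strict inequalities are expressed by negating `≤`, which is adequate as the order is total; in
  -- particular `¬ (ε ≤ 0#)` says that `ε` is positive.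
  Null : OpenSet → Set ℓ
  Null U = νᵒ U ≤ 0#

  null-⊆ : ∀ U V → U ⊆ᵒ V → Null V → Null U
  null-⊆ U V U⊆V = ≤-trans (νᵒ-mono U V U⊆V)

  fullᵒ-nonnull : ¬ Null fullᵒ
  fullᵒ-nonnull full≤0 =
    let m = 𝔐-open (Open⇒IsOpen full (proj₂ fullᵒ))
        (0≤X , 0≉X) = μ-positive
    in 0≉X (≤-antisym 0≤X (≤-trans (μ-monotone {full} _ m id) full≤0))

  -- Continuity makes zero the infimum of the measures along a local basis at `x`. If `ε` were below
  -- the measure of every cone at `x`, it would be a lower bound of that family.
  small-cone-at : ∀ x {ε} → ¬ (ε ≤ 0#) → ∃[ a ] ¬ (ε ≤ νᵒ (coneᵒ x a))
  small-cone-at x {ε} 0<ε = dne em λ none →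
    let (m , μx≈0) = continuous x
        (_ , inf) = μ-singleton x m Λ (mk↣ {to = id} id) U isLocalBasis
    in 0<ε (≤-trans (inf ε λ k →
         let isOpen = proj₁ (proj₁ isLocalBasis k)
             (a , a⊆) = IsOpen⇒Open (U k) isOpen x id
         in ≤-trans (dne em λ small → none (a , small)) (μ-monotone _ (𝔐-open isOpen) a⊆))
       (≤-reflexive μx≈0))
    where
    -- The basic sets avoiding x are replaced by the whole space, so that
    -- the local basis is indexed by all of Λ.
    U : ∣ Λ ∣ → Subset points
    U k = mkSubset (λ y → x ∈ˢ B k → y ∈ˢ B k) (λ y≈z y∈ x∈ → Subset.resp (B k) y≈z (y∈ x∈))

    U-isOpen : ∀ k → Dec (x ∈ˢ B k) → IsOpen (U k)
    U-isOpen k (yes x∈) = open-resp {B k} {U k} ((λ y∈ _ → y∈) , (λ y∈ → y∈ x∈)) (proj₁ basis k)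
    U-isOpen k (no x∉)  = open-resp {full} {U k} ((λ _ x∈ → ⊥-elim (x∉ x∈)) , (λ _ → tt)) open-full

    isLocalBasis : IsOpenLocalBasis (subspace (boundedTopology γ A) X) x U
    isLocalBasis = (λ k → U-isOpen k em , id) , λ V oV x∈V →
      let (k , x∈k , k⊆V) = proj₂ basis V oV x x∈V in k , λ y∈ → k⊆V (y∈ x∈k)

  -- Maximal cones with a given property, and absorption of covers.

  module Cut (G : Point → ∣ γ ∣ → Set ℓ)
             (G-resp : ∀ {x y a} → y ∈ˢ cone-at x a → G x a → G y a) where

    -- `G-resp` makes `G` independent of the centre chosen for a cone. The cone at the least level
    -- is the largest one around `x` with `G`.
    IsCut : Point → ∣ γ ∣ → Set ℓ
    IsCut x = IsLeast γ (G x)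

    cut-resp : ∀ {x y a} → y ∈ˢ cone-at x a → IsCut x a → IsCut y a
    cut-resp {x} {y} y∈ (g , least) = G-resp y∈ g , λ b b<a gyb →
      least b b<a (G-resp (cone-sym {x} {y} (cone-anti {x} (λ a<b → <-irrefl refl (<-trans a<b b<a)) {y} y∈)) gyb)

    -- The common point `z` inherits both cut levels, so they are equal and the two cones coincide.
    cut-meet : ∀ {x y z a b} → IsCut x a → IsCut y b → z ∈ˢ cone-at x a → z ∈ˢ cone-at y b →
               y ∈ˢ cone-at x a
    cut-meet {x} {y} {z} cx cy z∈x z∈y
      with refl ← least-unique {α = γ} (cut-resp {x} {z} z∈x cx) (cut-resp {y} {z} z∈y cy)
      = cone-trans {x} {z} {y} (cone-sym {y} {z} z∈y) z∈x

    cut-share : ∀ {x y z a b} → IsCut x a → IsCut y b → x ∈ˢ cone-at y b → z ∈ˢ cone-at y b →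
                z ∈ˢ cone-at x a
    cut-share {x} {y} {z} cx cy x∈y z∈y with refl ← least-unique {α = γ} cx (cut-resp {y} {x} x∈y cy)
      = cone-trans {x} {y} {z} z∈y (cone-sym {y} {x} x∈y)

  -- The maximal cones with the given property partition W; the sets of
  -- the partition are distinguished by the first basic set inside them.
  absorbed-cover-≤ : ∀ Y W →
    (∀ x → x ∈ᵒ W → ∃[ a ] coneᵒ x a ⊆ᵒ W × νᵒ Y + νᵒ (coneᵒ x a) ≤ νᵒ Y) → νᵒ W ≤ νᵒ Y
  absorbed-cover-≤ Y W small =
    ≤-trans (ν-mono {measurableᵒ W} {⋃ᵐ id↣ (measurableᵒ ∘ piece)} λ {x} → covers x)
      (finiteSubunionsSuffice id↣ (measurableᵒ ∘ piece) pieces-disjoint (νᵒ Y) λ ks V V⊆ →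
        let (O , _ , ks⊆O , O≤) = hull ks in
        ≤-trans (ν-mono {V} {measurableᵒ O} λ {x} x∈V → ks⊆O x (V⊆ x∈V)) O≤)
    where
    id↣ : ∣ Λ ∣ ↣ ∣ Λ ∣
    id↣ = mk↣ {to = id} id

    G : Point → ∣ γ ∣ → Set ℓ
    G x a = coneᵒ x a ⊆ᵒ W × νᵒ Y + νᵒ (coneᵒ x a) ≤ νᵒ Y

    G-resp : ∀ {x y a} → y ∈ˢ cone-at x a → G x a → G y a
    G-resp {x} {y} {a} y∈ (⊆W , absorbed) =
      (λ z z∈ → ⊆W z (y⊆x z z∈)) ,
      ≤-trans (+-mono-≤ ≤-refl (νᵒ-mono (coneᵒ y a) (coneᵒ x a) y⊆x)) absorbed
      where
      y⊆x : coneᵒ y a ⊆ᵒ coneᵒ x a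
      y⊆x z z∈ = cone-trans {x} {y} {z} z∈ y∈

    open Cut G (λ {x} {y} → G-resp {x} {y})

    -- The point `z` excludes an empty basic set, which would lie in every cone and distinguish
    -- none.
    Contains : Point → ∣ γ ∣ → ∣ Λ ∣ → Set ℓ
    Contains x a k = ∃[ z ] z ∈ˢ B k × (∀ y → y ∈ˢ B k → y ∈ˢ cone-at x a)

    contains-resp : ∀ {x y a k} → y ∈ˢ cone-at x a → Contains x a k → Contains y a k
    contains-resp {x} {y} y∈ (z , z∈k , k⊆x) =
      z , z∈k , λ w w∈k → cone-trans {y} {x} {w} (k⊆x w w∈k) (cone-sym {x} {y} y∈)

    In : ∣ Λ ∣ → Point → Set ℓ
    In k x = ∃[ a ] IsCut x a × IsLeast Λ (Contains x a) k

    in-resp : ∀ {k x y} ((a , _) : In k x) → y ∈ˢ cone-at x a → In k y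
    in-resp {k} {x} {y} (a , cut , (cont , least)) y∈ =
      a , cut-resp {x} {y} y∈ cut , contains-resp {x} {y} y∈ cont ,
      λ l l<k c → least l l<k (contains-resp {y} {x} (cone-sym {x} {y} y∈) c)

    piece : ∣ Λ ∣ → OpenSet
    piece k = mkSubset (In k) (λ {x} {y} x≈y p → in-resp {k} {x} {y} p (λ i _ → sym (x≈y i))) ,
              λ x p → proj₁ p , λ {y} → in-resp {k} {x} {y} p

    piece⊆cone : ∀ {k x y} ((a , _) : In k x) → In k y → y ∈ˢ cone-at x a
    piece⊆cone {k} {x} {y} (a , cutx , (z , z∈k , k⊆x) , _) (b , cuty , (_ , _ , k⊆y) , _) =
      cut-meet {x} {y} {z} cutx cuty (k⊆x z z∈k) (k⊆y z z∈k)

    pieces-disjoint : PairwiseDisjoint (measurableᵒ ∘ piece)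
    pieces-disjoint k l k≢l ((a , cutk , leastk) , (b , cutl , leastl))
      with refl ← least-unique {α = γ} cutk cutl = k≢l (least-unique {α = Λ} leastk leastl)

    covers : ∀ x → x ∈ᵒ W → ∃[ k ] In k x
    covers x x∈W =
      let (a , cut) = least-exists em γ (G x) (small x x∈W)
          (k , x∈k , k⊆) = proj₂ basis (cone-at x a) (Open⇒IsOpen (cone-at x a) (proj₂ (coneᵒ x a))) x (cone-refl x a)
          (l , least) = least-exists em Λ (Contains x a) (k , x , x∈k , λ y → k⊆ {y})
      in l , a , cut , least

    -- A nonempty piece lies in one cut cone. To add this cone to `O`, first remove it from `O`: the
    -- new union is then disjoint, and its measure is at most that of `Y` plus that of the cone,
    -- which `Y` absorbs.
    hull : ∀ ks → ∃[ O ] Y ⊆ᵒ O × (∀ x → Any (λ k → In k x) ks → x ∈ᵒ O) × νᵒ O ≤ νᵒ Y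
    hull [] = Y , (λ _ → id) , (λ _ ()) , ≤-refl
    hull (k ∷ ks) with hull ks | em {P = ∃ (In k)}
    ... | O , Y⊆O , ks⊆O , O≤ | no empty =
      O , Y⊆O , (λ { x (here x∈) → ⊥-elim (empty (x , x∈)) ; x (there x∈) → ks⊆O x x∈ }) , O≤
    ... | O , Y⊆O , ks⊆O , O≤ | yes (z , p@(a , ((_ , absorbed) , _) , _)) =
      O ∪ᵒ coneᵒ z a , (λ x → inj₁ ∘ Y⊆O x) ,
      (λ { x (here x∈) → inj₂ (piece⊆cone {k} {z} {x} p x∈) ; x (there x∈) → inj₁ (ks⊆O x x∈) }) ,
      ≤-trans (νᵒ-∖-≤ O (O ∪ᵒ coneᵒ z a) z a λ { _ (inj₁ y∈) _ → y∈ ; _ (inj₂ y∈) y∉ → ⊥-elim (y∉ y∈) })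
        (≤-trans (+-mono-≤ (≤-trans (νᵒ-mono (O ∖ (z , a)) O (λ _ → proj₁)) O≤) ≤-refl) absorbed)

  ∅ᵒ-null : Null ∅ᵒ
  ∅ᵒ-null = ≤-trans (μ-monotone {proj₁ ∅ᵒ} {emptySubset} _ _ id) (≤-reflexive μ-∅)

  -- The empty set absorbs null cones, so this is absorption with `∅ᵒ` for `Y`.
  null-cover : ∀ W → (∀ x → x ∈ᵒ W → ∃[ a ] coneᵒ x a ⊆ᵒ W × Null (coneᵒ x a)) → Null W
  null-cover W h = ≤-trans
    (absorbed-cover-≤ ∅ᵒ W λ x x∈W → let (a , ⊆W , null) = h x x∈W in
      a , ⊆W , ≤-trans (+-mono-≤ ∅ᵒ-null null) (≤-trans (≤-reflexive (identityˡ 0#)) (0-minimum _)))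
    ∅ᵒ-null

  -- By `null-cover` some point of `U` has only non-null cones inside `U`; a cone at this point is
  -- shrunk until its measure drops below `ε`.
  small-cone : ∀ U → ¬ Null U → ∀ {ε} → ¬ (ε ≤ 0#) →
    ∃[ x ] ∃[ a ] coneᵒ x a ⊆ᵒ U × ¬ Null (coneᵒ x a) × ¬ (ε ≤ νᵒ (coneᵒ x a))
  small-cone U U>0 {ε} ε>0 with em {P = ∃[ x ] x ∈ᵒ U × (∀ a → coneᵒ x a ⊆ᵒ U → ¬ Null (coneᵒ x a))}
  ... | no none = ⊥-elim (U>0 (null-cover U λ x x∈U → dne em λ no-null →
          none (x , x∈U , λ a ⊆U null → no-null (a , ⊆U , null))))
  ... | yes (x , x∈U , nonnull) =
    let (a , a⊆U) = proj₂ U x x∈U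
        (b , b<ε) = small-cone-at x ε>0
        (c , c≮a , c≮b) = upper-bound {α = γ} a b
        c⊆U = λ y y∈ → a⊆U {y} (cone-anti {x} c≮a {y} y∈)
    in x , c , c⊆U , nonnull c c⊆U ,
       λ ε≤ → b<ε (≤-trans ε≤ (νᵒ-mono (coneᵒ x c) (coneᵒ x b) λ y → cone-anti {x} c≮b {y}))

  -- Strict open sets and disjoint families of non-null sets.

  Strict : OpenSet → Set (lsuc ℓ)
  Strict C = ∀ Y U → Y ⊆ᵒ C → U ⊆ᵒ C → Disjointᵒ Y U → νᵒ Y + νᵒ U ≤ νᵒ Y → Null U

  -- If some Y ⊆ C absorbs an ε > 0, then it absorbs a cover of the space by
  -- cones of measure below ε, so C has full measure; but arbitrarily small
  -- positive values are attained.
  strict-exists : ∃[ C ] ¬ Null C × Strict C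
  strict-exists = dne em λ none →
    let full-minimal : ∀ C → ¬ Null C → νᵒ fullᵒ ≤ νᵒ C
        full-minimal C C>0 = dne em λ full≰C → none (C , C>0 , λ Y U Y⊆C _ _ absorbed → dne em λ U>0 →
          full≰C (≤-trans
            (absorbed-cover-≤ Y fullᵒ λ x _ → let (a , a<U) = small-cone-at x U>0 in
              a , (λ _ _ → tt) , ≤-trans (+-mono-≤ ≤-refl (≰⇒≥ a<U)) absorbed)
            (νᵒ-mono Y C Y⊆C)))
        (x , a , _ , D>0 , D<full) = small-cone fullᵒ fullᵒ-nonnull fullᵒ-nonnull
    in D<full (full-minimal (coneᵒ x a) D>0)

  -- Removing from the union W a cone D of positive measure below ε leaves
  -- less than ν W, hence at most the measure of finitely many of the sets;
  -- adding one more set to these makes up for D.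
  strict⇒no-infinite-family : ∀ C → Strict C → (E : ℕ → OpenSet) → (∀ n → E n ⊆ᵒ C) →
    (∀ i j → i ℕ.< j → Disjointᵒ (E i) (E j)) → ∀ {ε} → ¬ (ε ≤ 0#) → ¬ (∀ n → ε ≤ νᵒ (E n))
  strict⇒no-infinite-family C strict E E⊆C disj {ε} ε>0 ε≤E =
    let (x , a , D⊆E₀ , D>0 , D<ε) = small-cone (E 0) (ε>0 ∘ ≤-trans (ε≤E 0)) ε>0
    in D>0 (strict (W ∖ (x , a)) (coneᵒ x a) (λ y → W⊆C y ∘ proj₁) (λ y → E⊆C 0 y ∘ D⊆E₀ y) (λ _ → proj₂)
         (≤-trans
           (νᵒ-disjoint-≤ W (W ∖ (x , a)) (coneᵒ x a) (λ _ → proj₂) (λ _ → proj₁)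
             (λ y y∈ → lift 0 , D⊆E₀ y y∈))
           (W≤ x a D<ε)))
    where
    W : OpenSet
    W = ⋃ᵒ (E ∘ lower)

    W⊆C : W ⊆ᵒ C
    W⊆C y (n , y∈) = E⊆C (lower n) y y∈

    below : ℕ → OpenSet
    below k = ⋃ᵒ {Lift ℓ (∃[ n ] n ℕ.< k)} (E ∘ proj₁ ∘ lower)

    below-disjoint : ∀ k → Disjointᵒ (below k) (E k)
    below-disjoint k y (lift (n , n<k) , y∈) = disj n k n<k y y∈

    below+E≤ : ∀ k → νᵒ (below k) + νᵒ (E k) ≤ νᵒ (below (suc k))
    below+E≤ k = νᵒ-disjoint-≤ (below (suc k)) (below k) (E k) (below-disjoint k)
      (λ { y (lift (n , n<k) , y∈) → lift (n , ℕ.m<n⇒m<1+n n<k) , y∈ })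
      (λ y y∈ → lift (k , ℕ.n<1+n k) , y∈)

    -- Otherwise `below k` would absorb the disjoint set `E k`, and strictness would make `E k`
    -- null.
    W≰below : ∀ k → ¬ (νᵒ W ≤ νᵒ (below k))
    W≰below k W≤ = ε>0 (≤-trans (ε≤E k) (strict (below k) (E k)
      (λ { y (lift (n , _) , y∈) → E⊆C n y y∈ }) (E⊆C k) (below-disjoint k)
      (≤-trans (below+E≤ k) (≤-trans (νᵒ-mono (below (suc k)) W λ { y (lift (n , _) , y∈) → lift n , y∈ }) W≤))))

    pairwise : PairwiseDisjoint (measurableᵒ ∘ E ∘ lower)
    pairwise (lift i) (lift j) i≢j (y∈i , y∈j) with ℕ.<-cmp i j
    ... | tri< i<j _ _  = disj i j i<j _ y∈i y∈j
    ... | tri≈ _ refl _ = i≢j refl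
    ... | tri> _ _ j<i  = disj j i j<i _ y∈j y∈i

    list⊆below : (is : List (Lift ℓ ℕ)) → ∃[ k ] ∀ y → Any (λ i → y ∈ᵒ E (lower i)) is → y ∈ᵒ below k
    list⊆below [] = 0 , λ _ ()
    list⊆below (lift i ∷ is) = let (k , is⊆) = list⊆below is in suc i ℕ.⊔ k , λ
      { y (here y∈) → lift (i , ℕ.m≤m⊔n (suc i) k) , y∈
      ; y (there y∈) → let (lift (n , n<k) , y∈n) = is⊆ y y∈
                       in lift (n , ℕ.<-≤-trans n<k (ℕ.m≤n⊔m (suc i) k)) , y∈n }

    W≤ : ∀ x a → ¬ (ε ≤ νᵒ (coneᵒ x a)) → νᵒ W ≤ νᵒ (W ∖ (x , a))
    W≤ x a D<ε = ≤-trans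
      (ν-mono {measurableᵒ W} {⋃ᵐ ω↣Λ (measurableᵒ ∘ E ∘ lower)} id)
      (finiteSubunionsSuffice ω↣Λ (measurableᵒ ∘ E ∘ lower) pairwise _ λ is V V⊆ →
        let (k , is⊆below) = list⊆below is in
        dne em λ V≰ → W≰below (suc k) (≤-trans (νᵒ-∖-≤ W W x a λ _ y∈ _ → y∈) (≤-trans
          (+-mono-≤
            (≤-trans (≰⇒≥ V≰) (ν-mono {V} {measurableᵒ (below k)} λ {y} y∈ → is⊆below y (V⊆ y∈)))
            (≤-trans (≰⇒≥ D<ε) (ε≤E k)))
          (below+E≤ k))))

  -- Take a cone smaller in measure than `U` itself: if the rest were null, subadditivity would
  -- bound the measure of `U` by that of the cone.
  split : ∀ U → ¬ Null U →
    ∃[ x ] ∃[ a ] coneᵒ x a ⊆ᵒ U × ¬ Null (coneᵒ x a) × ¬ Null (U ∖ (x , a))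
  split U U>0 =
    let (x , a , D⊆U , D>0 , D<U) = small-cone U U>0 U>0
    in x , a , D⊆U , D>0 , λ null → D<U (≤-trans (νᵒ-∖-≤ U U x a λ _ y∈ _ → y∈)
         (≤-trans (+-mono-≤ null ≤-refl) (≤-reflexive (identityˡ _))))

  -- The remainder is split again and again: `E n` is the cone split off from `rest n`, and
  -- `rest (suc n)`, which contains all later terms, avoids it.
  disjoint-sequence : ∀ C → ¬ Null C → Σ[ E ∈ (ℕ → OpenSet) ]
    (∀ n → E n ⊆ᵒ C) × (∀ n → ¬ Null (E n)) × (∀ i j → i ℕ.< j → Disjointᵒ (E i) (E j))
  disjoint-sequence C C>0 = E , (λ n y → rest⊆ {0} {n} (ℕ.≤⇒≤′ ℕ.z≤n) y ∘ E⊆rest n y) , E>0 ,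
    λ i j i<j y y∈i y∈j → proj₂ (rest⊆ {suc i} {j} (ℕ.≤⇒≤′ i<j) y (E⊆rest j y y∈j)) y∈i
    where
    rest : ℕ → Σ[ U ∈ OpenSet ] ¬ Null U
    rest zero    = C , C>0
    rest (suc n) = let (U , U>0) = rest n
                       (x , a , _ , _ , left>0) = split U U>0
                   in U ∖ (x , a) , left>0

    E : ℕ → OpenSet
    E n = let (x , a , _) = split (proj₁ (rest n)) (proj₂ (rest n)) in coneᵒ x a

    E⊆rest : ∀ n → E n ⊆ᵒ proj₁ (rest n)
    E⊆rest n = let (_ , _ , ⊆ , _) = split (proj₁ (rest n)) (proj₂ (rest n)) in ⊆

    E>0 : ∀ n → ¬ Null (E n)
    E>0 n = let (_ , _ , _ , >0 , _) = split (proj₁ (rest n)) (proj₂ (rest n)) in >0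

    rest⊆ : ∀ {i j} → i ℕ.≤′ j → proj₁ (rest j) ⊆ᵒ proj₁ (rest i)
    rest⊆ (ℕ.≤′-reflexive refl) _ = id
    rest⊆ (ℕ.≤′-step i≤j) y       = rest⊆ i≤j y ∘ proj₁

  -- Coding the support of a strict set by binary sequences.

  module _ (C : OpenSet) (C-strict : Strict C) (E : ℕ → OpenSet) (E⊆C : ∀ n → E n ⊆ᵒ C)
           (E>0 : ∀ n → ¬ Null (E n)) (E-disjoint : ∀ i j → i ℕ.< j → Disjointᵒ (E i) (E j)) where

    ε : ℕ → Carrier
    ε n = νᵒ (E n)

    -- A positive `δ` below every `ε n` would make `E` an infinite disjoint family in `C` of
    -- measures at least `δ`.
    ε-coinitial : ∀ {δ} → ¬ (δ ≤ 0#) → ∃[ n ] ε n ≤ δ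
    ε-coinitial δ>0 = dne em λ none →
      strict⇒no-infinite-family C C-strict E E⊆C E-disjoint δ>0 λ n → ≰⇒≥ λ εₙ≤δ → none (n , εₙ≤δ)

    Small : ℕ → Point → ∣ γ ∣ → Set ℓ
    Small n x a = coneᵒ x a ⊆ᵒ C × ¬ (ε n ≤ νᵒ (coneᵒ x a))

    small-resp : ∀ n {x y a} → y ∈ˢ cone-at x a → Small n x a → Small n y a
    small-resp n {x} {y} {a} y∈ (x⊆C , small) =
      (λ z → x⊆C z ∘ y⊆x z) , λ ε≤ → small (≤-trans ε≤ (νᵒ-mono (coneᵒ y a) (coneᵒ x a) y⊆x))
      where
      y⊆x : coneᵒ y a ⊆ᵒ coneᵒ x a
      y⊆x z z∈ = cone-trans {x} {y} {z} z∈ y∈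

    module SmallCut n = Cut (Small n) (λ {x} {y} → small-resp n {x} {y})
    open SmallCut

    small-cut : ∀ n x → x ∈ᵒ C → ∃ (IsCut n x)
    small-cut n x x∈C =
      let (a , a⊆C) = proj₂ C x x∈C
          (b , b<ε) = small-cone-at x (E>0 n)
          (c , c≮a , c≮b) = upper-bound {α = γ} a b
      in least-exists em γ (Small n x) (c , (λ y y∈ → a⊆C {y} (cone-anti {x} c≮a {y} y∈)) ,
           λ ε≤ → b<ε (≤-trans ε≤ (νᵒ-mono (coneᵒ x c) (coneᵒ x b) λ y → cone-anti {x} c≮b {y})))

    -- A cell of the partition of `C` into maximal cones of measure below `ε n`. It comes with a
    -- centre, so one cell has many representatives.
    record LargePiece (n m : ℕ) : Set ℓ where
      constructor largePiece
      field
        point : Point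
        level : ∣ γ ∣
        cut   : IsCut n point level
        large : ε m ≤ νᵒ (coneᵒ point level)

    open LargePiece

    _∈ₚ_ : ∀ {n m} → Point → LargePiece n m → Set ℓ
    y ∈ₚ p = y ∈ˢ cone-at (point p) (level p)

    abstract
      -- Cells that are not covered by earlier ones are disjoint from them by `cut-meet`, so an
      -- infinite sequence of such cells would contradict strictness of `C`.
      finitely-many-large : ∀ n m →
        Σ[ ps ∈ List (LargePiece n m) ] ((p : LargePiece n m) → Any (λ q → point p ∈ₚ q) ps)
      finitely-many-large n m = finite-cover em (λ q p → point p ∈ₚ q) λ f separated →
        strict⇒no-infinite-family C C-strict
          (λ i → coneᵒ (point (f i)) (level (f i)))
          (λ i → proj₁ (proj₁ (cut (f i))))
          (λ i j i<j z z∈i z∈j → separated i j i<j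
            (cut-meet n {point (f i)} {point (f j)} {z} (cut (f i)) (cut (f j)) z∈i z∈j))
          (E>0 m) (λ i → large (f i))

    -- The position in the list is a natural number, so that all listed cells together are indexed
    -- by triples; positions past the end stand for the empty set.
    InNth : ℕ × ℕ × ℕ → Point → Set ℓ
    InNth (n , m , k) x = let (ps , _) = finitely-many-large n m in
      Σ[ i ∈ Fin (length ps) ] toℕ i ≡ k × x ∈ₚ lookup ps i

    inNth-resp : ∀ p {x y} → (∀ i → proj₁ x i ≡ proj₁ y i) → InNth p x → InNth p y
    inNth-resp _ x≈y (i , eq , x∈) = i , eq , λ j j<a → trans (sym (x≈y j)) (x∈ j j<a)

    code : Point → ℕ → Bool
    code x t = does (em {P = InNth (unpair³ t) x})

    code-cong : ∀ {x y} → (∀ i → proj₁ x i ≡ proj₁ y i) → ∀ t → code x t ≡ code y t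
    code-cong {x} {y} x≈y t = does-⇔
      (mk⇔ (inNth-resp (unpair³ t) {x} {y} x≈y) (inNth-resp (unpair³ t) {y} {x} (sym ∘ x≈y))) em em

    code-reflects : ∀ {x y} → (∀ t → code x t ≡ code y t) → ∀ p → InNth p x → InNth p y
    code-reflects {x} {y} same p x∈ =
      let (t , eq) = unpair³-surjective p in
      subst (λ p → InNth p y) eq
        (does-reflects (em {P = InNth (unpair³ t) x}) (em {P = InNth (unpair³ t) y}) (same t)
          (subst (λ p → InNth p x) (sym eq) x∈))

    Support : Point → Set ℓ
    Support x = x ∈ᵒ C × (∀ a → coneᵒ x a ⊆ᵒ C → ¬ Null (coneᵒ x a))

    support-resp : ∀ {x y} → (∀ i → proj₁ x i ≡ proj₁ y i) → Support x → Support y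
    support-resp {x} {y} x≈y (x∈C , nonnull) =
      Subset.resp (proj₁ C) x≈y x∈C ,
      λ a y⊆C null → nonnull a (λ z z∈ → y⊆C z (x⊆y a z z∈))
        (null-⊆ (coneᵒ x a) (coneᵒ y a) (x⊆y a) null)
      where
      x⊆y : ∀ a → coneᵒ x a ⊆ᵒ coneᵒ y a
      x⊆y a z z∈ i i<a = trans (z∈ i i<a) (x≈y i)

    -- If `i` were the last level, the cone of `x` at `i` would be its smallest cone. It is
    -- non-null, yet some cone at `x` has smaller measure.
    support-limit : ∀ {x} → Support x → ∀ i → ∃[ a ] i < a
    support-limit {x} (x∈C , nonnull) i = dne em λ i-last →
      let (a , a⊆C) = proj₂ C x x∈C
          i≮ = λ b i<b → i-last (b , i<b)
          i⊆C = λ y y∈ → a⊆C {y} (cone-anti {x} (i≮ a) {y} y∈)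
          (b , b<i) = small-cone-at x (nonnull i i⊆C)
      in b<i (νᵒ-mono (coneᵒ x i) (coneᵒ x b) λ y → cone-anti {x} (i≮ b) {y})

    -- The cut cone of `x` is large, so `x` lies in some listed cell. The code records the position
    -- of this cell; hence `y` lies in it too, and the cell is the cut cone of `x`.
    same-piece : ∀ {x y n m a} → (∀ t → code x t ≡ code y t) → IsCut n x a → ε m ≤ νᵒ (coneᵒ x a) →
                 y ∈ˢ cone-at x a
    same-piece {x} {y} {n} {m} {a} same cutx largex =
      transfer (proj₂ (finitely-many-large n m) (largePiece x a cutx largex))
      where
      ps : List (LargePiece n m)
      ps = proj₁ (finitely-many-large n m)

      share : (q : LargePiece n m) → x ∈ₚ q → y ∈ₚ q → y ∈ˢ cone-at x a
      share q = cut-share n {x} {point q} {y} cutx (cut q)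

      transfer : Any (λ q → x ∈ₚ q) ps → y ∈ˢ cone-at x a
      transfer x∈ps =
        let (j , j≡ , y∈) = code-reflects {x} {y} same (n , m , toℕ (Any.index x∈ps))
                              (Any.index x∈ps , refl , Any.lookup-index x∈ps)
        in share (lookup ps (Any.index x∈ps)) (Any.lookup-index x∈ps)
             (subst (λ j → y ∈ₚ lookup ps j) (Fin.toℕ-injective j≡) y∈)

    cone-beyond : ∀ {x} → Support x → ∀ i → ∃[ c ] i < c × coneᵒ x c ⊆ᵒ C
    cone-beyond {x} s i =
      let (a , a⊆C) = proj₂ C x (proj₁ s)
          (b , i<b) = support-limit {x} s i
          (c , c≮a , c≮b) = upper-bound {α = γ} a b
      in c , <-≮-trans {α = γ} i<b c≮b , λ y y∈ → a⊆C {y} (cone-anti {x} c≮a {y} y∈)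

    -- Choose `ε n` at most the measure of the cone at `c`. A cone at an earlier level contains that
    -- one, so its measure is not below `ε n`.
    cut-beyond : ∀ {x c} → Support x → coneᵒ x c ⊆ᵒ C → ∃[ n ] ∀ a → IsCut n x a → ¬ (a < c)
    cut-beyond {x} {c} (_ , nonnull) c⊆C =
      let (n , εₙ≤c) = ε-coinitial (nonnull c c⊆C)
      in n , λ a ((_ , a<εₙ) , _) a<c → a<εₙ (≤-trans εₙ≤c
           (νᵒ-mono (coneᵒ x c) (coneᵒ x a) λ y → cone-anti {x} (λ c<a → <-irrefl refl (<-trans c<a a<c)) {y}))

    -- For a coordinate `i`, take `n` so large a refinement that the cut of `x` lies beyond `i`. The
    -- cut cone is non-null, hence of measure at least some `ε m`, and `same-piece` puts `y` into
    -- it.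
    code-injective : ∀ {x y} → Support x → (∀ t → code x t ≡ code y t) → ∀ i → proj₁ y i ≡ proj₁ x i
    code-injective {x} {y} s same i =
      let (c , i<c , c⊆C) = cone-beyond {x} s i
          (n , beyond) = cut-beyond {x} {c} s c⊆C
      in in-cut {c} {n} i<c beyond (small-cut n x (proj₁ s))
      where
      in-cut : ∀ {c n} → i < c → (∀ a → IsCut n x a → ¬ (a < c)) → ∃ (IsCut n x) → proj₁ y i ≡ proj₁ x i
      in-cut {c} {n} i<c beyond (a , cutx) =
        let (m , εₘ≤a) = ε-coinitial (proj₂ s a (proj₁ (proj₁ cutx)))
        in same-piece {x} {y} {n} {m} {a} same cutx εₘ≤a i (<-≮-trans {α = γ} i<c (beyond a cutx))

    -- The support embeds into the binary sequences, hence into Λ, so it is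
    -- a union of at most λ null singletons.
    strict-null : Injection (ℕ →-setoid Bool) (setoid ∣ Λ ∣) → Null C
    strict-null φ = ≤-trans
      (ν-split-≤ {measurableᵒ C} (measurableᵒ outside) (⋃ᵐ id↣ fibre)
        (λ { ((_ , a , ⊆C , null) , _ , (_ , nonnull) , _) → nonnull a ⊆C null })
        λ {x} x∈C → decide x x∈C em)
      (≤-trans (+-mono-≤ outside-null fibres-null) (≤-reflexive (identityˡ 0#)))
      where
      open Injection φ using (to; injective) renaming (cong to to-cong)

      id↣ : ∣ Λ ∣ ↣ ∣ Λ ∣
      id↣ = mk↣ {to = id} id

      HasNullCone : Point → Set ℓ
      HasNullCone x = ∃[ a ] coneᵒ x a ⊆ᵒ C × Null (coneᵒ x a)

      hasNullCone-resp : ∀ {x y} ((a , _) : HasNullCone x) → y ∈ˢ cone-at x a → HasNullCone y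
      hasNullCone-resp {x} {y} (a , ⊆C , null) y∈ =
        a , (λ z → ⊆C z ∘ y⊆x z) , null-⊆ (coneᵒ y a) (coneᵒ x a) y⊆x null
        where
        y⊆x : coneᵒ y a ⊆ᵒ coneᵒ x a
        y⊆x z z∈ = cone-trans {x} {y} {z} z∈ y∈

      outside : OpenSet
      outside = mkSubset (λ x → x ∈ᵒ C × HasNullCone x)
          (λ {x} {y} x≈y (x∈C , h) → Subset.resp (proj₁ C) x≈y x∈C ,
            hasNullCone-resp {x} {y} h (λ i _ → sym (x≈y i))) ,
        λ { x (x∈C , h@(a , ⊆C , _)) → a , λ {y} y∈ → ⊆C y y∈ , hasNullCone-resp {x} {y} h y∈ }

      outside-null : Null outside
      outside-null = null-cover outside λ { x (_ , h@(a , ⊆C , null)) →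
        a , (λ y y∈ → ⊆C y y∈ , hasNullCone-resp {x} {y} h y∈) , null }

      Fibre : ∣ Λ ∣ → Subset points
      Fibre k = mkSubset (λ x → Support x × to (code x) ≡ k)
        (λ {x} {y} x≈y (s , eq) → support-resp {x} {y} x≈y s ,
          trans (to-cong (code-cong {y} {x} (sym ∘ x≈y))) eq)

      fibre-unique : ∀ {k x} → x ∈ˢ Fibre k → Fibre k ⊆ˢ ｛ x ｝ˢ
      fibre-unique {k} {x} (s , eq) {y} (_ , eq′) =
        code-injective {x} {y} s (injective (trans eq (sym eq′)))

      fibre-measurable : ∀ k → Dec (∃[ x ] x ∈ˢ Fibre k) → Fibre k ∈ 𝔐
      fibre-measurable k (no empty) =
        𝔐-resp {emptySubset} {Fibre k} ((λ { (() , _) }) , λ {x} x∈ → ⊥-elim (empty (x , x∈))) (𝔐-open open-∅)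
      fibre-measurable k (yes (x , x∈)) =
        𝔐-resp {｛ x ｝ˢ} {Fibre k}
          ((λ {y} y≈x → Subset.resp (Fibre k) {x} {y} (sym ∘ y≈x) x∈) , λ {y} → fibre-unique {k} {x} x∈ {y})
          (proj₁ (continuous x))

      fibre : ∣ Λ ∣ → MeasurableSet
      fibre k = Fibre k , fibre-measurable k em

      -- A fibre is empty or one point up to equality. The point is added only if it is not yet in
      -- `O`, so that additivity for disjoint sets applies.
      hull : ∀ ks → ∃[ O ] (∀ x → Any (λ k → x ∈ˢ Fibre k) ks → x ∈ᵐ O) × ν O ≤ 0#
      hull [] = measurableᵒ ∅ᵒ , (λ _ ()) , ∅ᵒ-null
      hull (k ∷ ks) with hull ks | em {P = ∃[ x ] x ∈ˢ Fibre k}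
      ... | O , ks⊆O , O≤0 | no empty =
        O , (λ { x (here x∈) → ⊥-elim (empty (x , x∈)) ; x (there x∈) → ks⊆O x x∈ }) , O≤0
      ... | O , ks⊆O , O≤0 | yes (x , x∈k) with em {P = x ∈ᵐ O}
      ...   | yes x∈O = O ,
        (λ { y (here y∈k) → Subset.resp (proj₁ O) {x} {y} (sym ∘ fibre-unique {k} {x} x∈k {y} y∈k) x∈O
           ; y (there y∈) → ks⊆O y y∈ }) , O≤0
      ...   | no x∉O = O ∪ᵐ singleton ,
        (λ { y (here y∈k) → ∪-right {O} {singleton} {y} (fibre-unique {k} {x} x∈k {y} y∈k)
           ; y (there y∈) → ∪-left {O} {singleton} {y} (ks⊆O y y∈) }) ,
        ≤-trans
          (≤-reflexive (ν-∪ O singleton λ {y} (y∈O , y≈x) → x∉O (Subset.resp (proj₁ O) {y} {x} y≈x y∈O)))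
          (≤-trans (+-mono-≤ O≤0 (≤-reflexive (proj₂ (continuous x)))) (≤-reflexive (identityˡ 0#)))
        where
        singleton : MeasurableSet
        singleton = ｛ x ｝ˢ , proj₁ (continuous x)

      fibres-null : ν (⋃ᵐ id↣ fibre) ≤ 0#
      fibres-null = finiteSubunionsSuffice id↣ fibre
        (λ { k l k≢l ((_ , x∈k) , (_ , x∈l)) → k≢l (trans (sym x∈k) x∈l) }) 0#
        λ ks V V⊆ → let (O , ks⊆O , O≤0) = hull ks in
          ≤-trans (ν-mono {V} {O} λ {x} x∈V → ks⊆O x (V⊆ x∈V)) O≤0

      decide : ∀ x → x ∈ᵒ C → Dec (HasNullCone x) → x ∈ᵒ outside ⊎ x ∈ᵐ ⋃ᵐ id↣ fibre
      decide x x∈C (yes h) = inj₁ (x∈C , h)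
      decide x x∈C (no none) =
        inj₂ (to (code x) , (x∈C , λ a ⊆C null → none (a , ⊆C , null)) , refl)

  no-continuous-measure : ¬ Injection (ℕ →-setoid Bool) (setoid ∣ Λ ∣)
  no-continuous-measure φ =
    let (C , C>0 , C-strict) = strict-exists
        (E , E⊆C , E>0 , disj) = disjoint-sequence C C>0
    in C>0 (strict-null C C-strict E E⊆C E>0 disj φ)

-- Passage to a well-ordered weight and the degenerate length zero.

ℕ↣ : ∀ {ℓ} {Λ : Set ℓ} → 𝔠≤ Λ → Lift ℓ ℕ ↣ Λ
ℕ↣ φ = mk↣ {to = λ n → to (lower n ℕ.≡ᵇ_)} λ {m} {n} eq →
  cong lift (sym (ℕ.≡ᵇ⇒≡ (lower n) (lower m)
    (subst T (injective eq (lower m)) (ℕ.≡⇒≡ᵇ (lower m) (lower m) refl))))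
  where open Injection φ using (to; injective)

theorem1p3 : (∀ {a : Level} → ExcludedMiddle a) → (∀ (a : Level) → AxiomOfChoice a) →
    ∀ {ℓ : Level} (γ : Ordinal ℓ) (A : Set ℓ) (X : Subset (sequencesOfLength γ A)) (Λ : Set ℓ) →
    HasWeight (subspace (boundedTopology γ A) X) Λ → 𝔠≤ Λ →
    (𝕊 : PositivelyTotallyOrderedMonoid ℓ) (Σ𝕊 : InfinitarySum 𝕊) →
    ¬ (Σ[ M ∈ WeakMeasureSpace (subspace (boundedTopology γ A) X) Λ Σ𝕊 ] WeakMeasureSpace.Continuous M)
theorem1p3 em choice {ℓ} γ A X Λ ((B , basis , _) , _) φ 𝕊 Σ𝕊 (M , continuous) with em {P = ∣ γ ∣}
... | yes γ₀ =
  let (choose , choose-∈ , choose-cong) = choice ℓ Λ in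
  no-continuous-measure em {γ = γ} γ₀ {X = X} (wellOrder em choose choose-∈ choose-cong) (ℕ↣ φ)
    B basis M continuous φ
-- For empty `γ` the space has at most one point up to equality, so its measure is that of a
-- singleton or of the empty set, hence zero.
... | no empty = proj₂ μ-positive (antisym (0-minimum _) (subsingleton em))
  where
  open TopologicalSpace (subspace (boundedTopology γ A) X) using (Point; open-full; open-∅)
  open PositivelyTotallyOrderedMonoid 𝕊
  open IsTotalOrder isTotalOrder using (antisym; reflexive) renaming (trans to ≤-trans)
  open WeakMeasureSpace M
  subsingleton : Dec Point → μ𝔐 full (𝔐-open open-full) ≤ 0#
  subsingleton (yes x) = let (m , μx≈0) = continuous x in
    ≤-trans (μ-monotone _ m λ _ i → ⊥-elim (empty i)) (reflexive μx≈0)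
  subsingleton (no no-point) =
    ≤-trans (μ-monotone _ (𝔐-open open-∅) λ {x} _ → ⊥-elim (no-point x)) (reflexive μ-∅)
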